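{- $\mathsf{LREC}\not\le\mathsf{TC{+}C}$ on the class of all directed trees; that is, there is an $\mathsf{LREC}[\{E\}]$-formula that is not equivalent, on the class of all directed trees, to any $\mathsf{TC{+}C}[\{E\}]$-formula.
   Context: A directed tree is a finite rooted tree with all edges directed away from the root, viewed as a structure over the vocabulary $\{E\}$ with $E$ binary. Basic conventions. $[m,n]=\{p\in\mathbb{N}: m\le p\le n\}$. A vocabulary $\tau$ is a finite set of relation symbols $R$ with arities $\mathrm{ar}(R)$. A $\tau$-structure $A$ has a non-empty finite universe $V(A)$ and relations $R(A)\subseteq V(A)^{\mathrm{ar}(R)}$. Every structure $A$ is equipped with a number sort $N(A)=[0,|V(A)|]$. Variables are either structure variables (ranging over $V(A)$) or number variables (ranging over $N(A)$); $A^u$ is $V(A)$ or $N(A)$ accordingly, and $A^{(u_1,\dots,u_k)}=A^{u_1}\times\dots\times A^{u_k}$. Two tuples of variables are compatible if they have the same length and the same types position by position. For a tuple $\bar u$, $\tilde u$ is the set of its entries. An assignment $\alpha$ in $A$ maps each variable $u$ to an element of $A^u$; $\alpha[\bar a/\bar u]$ is $\alpha$ modified to map $\bar u$ to $\bar a$. For $\bar n=(n_1,\dots,n_k)\in N(A)^k$ let $\langle\bar n\rangle=\langle\bar n\rangle_A=\sum_{i=1}^k n_i(|V(A)|+1)^{i-1}$. The logic $\mathsf{FO{+}C}[\tau]$ extends (two-sorted) first-order logic over $\tau$ by formulae $p\le q$ for number variables $p,q$, and $\#\bar u\,\psi=\bar p$ for a tuple $\bar u$ of variables, a tuple $\bar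 p$ of number variables and a formula $\psi$; the latter holds in $(A,\alpha)$ iff $|\{\bar a\in A^{\bar u}:(A,\alpha[\bar a/\bar u])\models\psi\}|=\langle\alpha(\bar p)\rangle_A$. Write $\varphi[A,\alpha;\bar u]=\{\bar a\in A^{\bar u}:(A,\alpha[\bar a/\bar u])\models\varphi\}$. $\mathsf{TC{+}C}$ is the extension of $\mathsf{FO{+}C}$ by the transitive closure operator: $[\mathrm{tc}_{\bar u,\bar v}\,\psi](\bar s,\bar t)$ (all four tuples pairwise compatible) holds in $(A,\alpha)$ iff $(\alpha(\bar s),\alpha(\bar t))$ belongs to the reflexive transitive closure of the relation $\psi[A,\alpha;\bar u,\bar v]$ on $A^{\bar u}$. The logic $\mathsf{LREC}$. $\mathsf{LREC}[\tau]$ is obtained by adding to the formation rules of $\mathsf{FO{+}C}[\tau]$ the rule: if $\bar u,\bar v,\bar w$ are compatible tuples of variables, $\bar p,\bar r$ are non-empty tuples of number variables, and $\varphi_E,\varphi_C$ are $\mathsf{LREC}[\tau]$-formulae, then $\varphi=[\mathrm{lrec}_{\bar u,\bar v,\bar p}\;\varphi_E,\varphi_C](\bar w,\bar r)$ is an $\mathsf{LREC}[\tau]$-formula, with free variables $(\mathrm{free}(\varphi_E)\setminus(\tilde u\cup\tilde v))\cup(\mathrm{free}(\varphi_C)\setminus(\tilde u\cup\tilde p))\cup\tilde w\cup\tilde r$. Semantics: given $(A,\alpha)$, let $\mathtt V=A^{\bar u}$, $\mathtt E=\varphi_E[A,\alpha;\bar u,\bar v]\subseteq\mathtt V^2$,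 and for $\bar a\in\mathtt V$ let $\mathtt C(\bar a)=\{\langle\bar n\rangle:\bar n\in\varphi_C[A,\alpha[\bar a/\bar u];\bar p]\}$, $\bar a\mathtt E=\{\bar b:\bar a\bar b\in\mathtt E\}$, $\mathtt E\bar b=\{\bar a:\bar a\bar b\in\mathtt E\}$. The relation $X\subseteq\mathtt V\times\mathbb N$ defined by $\varphi$ in $(A,\alpha)$ is given recursively by: $(\bar a,\ell)\in X$ iff $\ell>0$ and $\bigl|\{\bar b\in\bar a\mathtt E:(\bar b,\lfloor(\ell-1)/|\mathtt E\bar b|\rfloor)\in X\}\bigr|\in\mathtt C(\bar a)$. Then $(A,\alpha)\models\varphi$ iff $(\alpha(\bar w),\langle\alpha(\bar r)\rangle)\in X$. -}

module Defs where

open import Data.Bool.Base using (Bool; T)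
open import Data.Empty using (⊥)
open import Data.Fin.Base using (Fin; toℕ; zero; suc)
open import Data.List.Base using (List; []; _∷_; _++_; length; replicate)
open import Data.List.Membership.Propositional using (_∈_)
open import Data.List.Relation.Unary.All as All using (All; []; _∷_)
open import Data.List.Relation.Unary.All.Properties using (++⁺)
open import Data.List.Relation.Unary.Unique.Propositional using (Unique)
open import Data.Nat.Base using (ℕ; zero; suc; _+_; _*_; _≤_; _<_; _/_; s≤s)
open import Data.Nat.DivMod using (m/n≤m)
open import Data.Nat.Induction using (Acc; acc; <-wellFounded)
open import Data.Product.Base using (∃-syntax; _×_; _,_)
open import Data.Sum.Base using (_⊎_)
open import Data.Vec.Base as Vec using (Vec; []; _∷_)
open import Function.Bundles using (_⇔_; _↔_)
open import Relation.Binary.Construct.Closure.ReflexiveTransitive using (Star)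
open import Relation.Binary.PropositionalEquality using (_≡_)
open import Relation.Nullary using (¬_)

record Vocabulary : Set where
  field
    symbols : ℕ
    arity   : Fin symbols → ℕ

open Vocabulary public

-- Universes are finite and non-empty.  Relations are Bool-valued, so they are
-- arbitrary subsets in the classical sense; every semantic clause below is
-- then decidable, and the Set-valued connectives agree with the classical ones.
record Structure (τ : Vocabulary) : Set₁ where
  field
    V       : Set
    pred∣V∣ : ℕ
    finite  : V ↔ Fin (suc pred∣V∣)
    rel     : (R : Fin (symbols τ)) → Vec V (arity τ R) → Bool

  ∣V∣ : ℕ
  ∣V∣ = suc pred∣V∣

  -- [0 , ∣V∣], so both end points are included.
  N : Set
  N = Fin (suc ∣V∣)

data Sort : Set where
  structure number : Sort

numbers : ℕ → List Sort
numbers k = replicate k number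

-- ∣ P ∣≡ n : the set { x ∣ P x } is finite with exactly n elements.  (Members
-- are counted, not proofs of membership.)
∣_∣≡_ : {X : Set} → (X → Set) → ℕ → Set
∣ P ∣≡ n = ∃[ xs ] Unique xs × (∀ x → x ∈ xs ⇔ P x) × length xs ≡ n

module _ {τ : Vocabulary} (A : Structure τ) where
  open Structure A

  Element : Sort → Set
  Element structure = V
  Element number    = N

  Tuple : List Sort → Set
  Tuple = All Element

  -- Σᵢ nᵢ (∣V∣ + 1)^(i-1), least significant digit first, in Horner form.
  ⟨_⟩ : ∀ {k} → Tuple (numbers k) → ℕ
  ⟨_⟩ {zero}  []       = 0
  ⟨_⟩ {suc k} (n ∷ ns) = toℕ n + ⟨ ns ⟩ * suc ∣V∣

data Logic : Set where
  TC+C LREC : Logic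

-- A variable of sort s among the variables in scope Γ.
Var : List Sort → Sort → Set
Var Γ s = s ∈ Γ

-- Tuples of variables, with repetitions allowed.  Compatible tuples are those
-- with the same list of sorts.
Vars : List Sort → List Sort → Set
Vars Γ = All (Var Γ)

-- Formulae are well scoped: all free variables are in Γ, and a binder puts its
-- variables, which are thus pairwise distinct, in front of Γ.  Both logics
-- share the constructors of FO+C.
data Formula (τ : Vocabulary) : Logic → List Sort → Set where
  rel  : ∀ {L Γ} (R : Fin (symbols τ)) → Vec (Var Γ structure) (arity τ R) →
         Formula τ L Γ
  _≐_  : ∀ {L Γ s} → Var Γ s → Var Γ s → Formula τ L Γ
  _≼_  : ∀ {L Γ} → Var Γ number → Var Γ number → Formula τ L Γ
  ¬′_  : ∀ {L Γ} → Formula τ L Γ → Formula τ L Γ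
  _∧_  : ∀ {L Γ} → Formula τ L Γ → Formula τ L Γ → Formula τ L Γ
  _∨_  : ∀ {L Γ} → Formula τ L Γ → Formula τ L Γ → Formula τ L Γ
  ∃′   : ∀ {L Γ} s → Formula τ L (s ∷ Γ) → Formula τ L Γ
  ∀′   : ∀ {L Γ} s → Formula τ L (s ∷ Γ) → Formula τ L Γ

  -- #ū ψ = p̄
  #    : ∀ {L Γ} us {k} → Formula τ L (us ++ Γ) → Vars Γ (numbers k) →
         Formula τ L Γ

  -- [tc_{ū,v̄} ψ](s̄ , t̄)
  tc   : ∀ {Γ} us → Formula τ TC+C (us ++ us ++ Γ) → Vars Γ us → Vars Γ us →
         Formula τ TC+C Γ

  -- [lrec_{ū,v̄,p̄} φE , φC](w̄ , r̄), with ∣p̄∣ = suc k and ∣r̄∣ = suc l.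
  -- In φE the scope is ū , v̄ , Γ; in φC it is p̄ , ū , Γ.
  lrec : ∀ {Γ} us k {l} → Formula τ LREC (us ++ us ++ Γ) →
         Formula τ LREC (numbers (suc k) ++ us ++ Γ) →
         Vars Γ us → Vars Γ (numbers (suc l)) → Formula τ LREC Γ

-- The relation X defined by limited recursion from a graph E and labels C, by
-- recursion on ℓ.  Any b with E a b has positive in-degree, so writing the
-- in-degree as suc d loses nothing.
module LimitedRecursion {𝕍 : Set} (E : 𝕍 → 𝕍 → Set) (C : 𝕍 → ℕ → Set) where

  XAcc : 𝕍 → (ℓ : ℕ) → Acc _<_ ℓ → Set
  XAcc a zero    _         = ⊥
  XAcc a (suc m) (acc rec) =
    ∃[ c ] C a c ×
      ∣ (λ b → E a b × ∃[ d ] (∣ (λ a′ → E a′ b) ∣≡ suc d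
                 × XAcc b (m / suc d) (rec (s≤s (m/n≤m m (suc d)))))) ∣≡ c

  X : 𝕍 → ℕ → Set
  X a ℓ = XAcc a ℓ (<-wellFounded ℓ)

module _ {τ : Vocabulary} (A : Structure τ) where

  Assignment : List Sort → Set
  Assignment = Tuple A

  _⟦_⟧ : ∀ {Γ s} → Assignment Γ → Var Γ s → Element A s
  α ⟦ u ⟧ = All.lookup α u

  _⟦_⟧* : ∀ {Γ us} → Assignment Γ → Vars Γ us → Tuple A us
  α ⟦ us ⟧* = All.map (λ u → α ⟦ u ⟧) us

  infix 4 _⊨_

  _⊨_ : ∀ {L Γ} → Assignment Γ → Formula τ L Γ → Set
  α ⊨ rel R us       = T (Structure.rel A R (Vec.map (λ u → α ⟦ u ⟧) us))
  α ⊨ (u ≐ v)        = α ⟦ u ⟧ ≡ α ⟦ v ⟧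
  α ⊨ (p ≼ q)        = toℕ (α ⟦ p ⟧) ≤ toℕ (α ⟦ q ⟧)
  α ⊨ (¬′ φ)         = ¬ (α ⊨ φ)
  α ⊨ (φ ∧ ψ)        = (α ⊨ φ) × (α ⊨ ψ)
  α ⊨ (φ ∨ ψ)        = (α ⊨ φ) ⊎ (α ⊨ ψ)
  α ⊨ ∃′ s φ         = ∃[ a ] (a ∷ α ⊨ φ)
  α ⊨ ∀′ s φ         = ∀ a → a ∷ α ⊨ φ
  α ⊨ # us ψ ps      = ∣ (λ (a : Tuple A us) → ++⁺ a α ⊨ ψ) ∣≡ ⟨_⟩ A (α ⟦ ps ⟧*)
  α ⊨ tc us ψ ss ts  =
    Star (λ (a b : Tuple A us) → ++⁺ a (++⁺ b α) ⊨ ψ) (α ⟦ ss ⟧*) (α ⟦ ts ⟧*)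
  α ⊨ lrec us k φE φC ws rs = X (α ⟦ ws ⟧*) (⟨_⟩ A (α ⟦ rs ⟧*))
    where
    open LimitedRecursion
      (λ (a b : Tuple A us) → ++⁺ a (++⁺ b α) ⊨ φE)
      (λ (a : Tuple A us) c → ∃[ n ] (++⁺ n (++⁺ a α) ⊨ φC) × ⟨_⟩ A {suc k} n ≡ c)

EquivalentOn : ∀ {τ L L′ Γ} → (Structure τ → Set) → Formula τ L Γ → Formula τ L′ Γ → Set₁
EquivalentOn {τ} 𝒞 φ ψ =
  ∀ (A : Structure τ) → 𝒞 A → ∀ α → (_⊨_ A α φ ⇔ _⊨_ A α ψ)

τE : Vocabulary
τE = record { symbols = 1 ; arity = λ _ → 2 }

Edge : (A : Structure τE) → Structure.V A → Structure.V A → Set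
Edge A u v = T (Structure.rel A zero (u ∷ v ∷ []))

-- Finiteness is part of Structure.
record IsDirectedTree (A : Structure τE) : Set where
  open Structure A
  field
    root          : V
    root-orphan   : ∀ u → ¬ Edge A u root
    unique-parent : ∀ {u u′ v} → Edge A u v → Edge A u′ v → u ≡ u′
    reachable     : ∀ v → Star (Edge A) root v

-- The formula counts, by limited recursion, how many children of a vertex hold;
-- a vertex holds if it has exactly 0 or exactly Q such children, where Q is the
-- value of a free variable.  The trees carry hidden kinds in Bool², of which
-- only (true , true) holds: besides Q plain children of each kind, a vertex has
-- for each of the two components x of its kind a child of kind (false , x) and
-- one of kind (true , not x).  So a vertex has Q children that hold, plus one
-- for each component that is false.
--
-- Consider lists of pairs of vertices that preserve the lengths of common
-- prefixes, and the kinds along the paths at heights below d.  As long as such a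
-- list has fewer than Q pairs it extends to any further vertex on either side,
-- with the same d, by copying the rest of its path below an unused plain child.
-- Hence paths of tuples lift, which takes care of tc.  The children of a vertex
-- reveal its kind, but its grandchildren do not: there are equally many of each
-- kind, whatever the kind of the vertex.  Hence there is a bijection of the
-- vertices that extends the list by any one further pair at the cost of two
-- heights, which takes care of counting.  So a TC+C formula cannot tell two
-- children of the root of different kinds apart if the tree is high and Q large.

module Submission where

open import Defs
open import Data.Bool.Base using (Bool; true; false; T; _xor_)
import Data.Bool.Properties as Bool
open import Data.Fin.Base using (Fin; zero; suc; toℕ; fromℕ<; punchOut)
import Data.Fin.Properties as Fin
open import Data.List.Base using (List; []; _∷_; _++_; length; lookup; map; mapMaybe; allFin)
open import Data.List.Membership.Propositional using (_∈_; _∉_)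
open import Data.List.Membership.Propositional.Properties using (∈-map⁺; ∈-map⁻; ∈-allFin)
open import Data.List.Properties using (length-map; length-++; length-tabulate)
open import Data.List.Relation.Unary.All as All using ([]; _∷_)
open import Data.List.Relation.Unary.All.Properties using (++⁺)
open import Data.List.Relation.Unary.AllPairs using ([]; _∷_)
open import Data.List.Relation.Unary.Any as Any using (here; there)
open import Data.List.Relation.Unary.Any.Properties using (lookup-index)
import Data.List.Relation.Unary.Unique.Propositional.Properties as Unique
open import Data.Maybe.Base using (Maybe; just; nothing)
open import Data.Nat.Base using (ℕ; zero; suc; _+_; _*_; _≤_; _<_; _/_; _⊔_; z≤n; s≤s; s≤s⁻¹)
open import Data.Nat.DivMod using (n/1≡n)
open import Data.Nat.Induction using (Acc; acc)
import Data.Nat.Properties as ℕ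
open import Data.Product.Base using (∃-syntax; Σ; Σ-syntax; _×_; _,_; proj₁; proj₂)
open import Data.Product.Function.Dependent.Propositional using (Σ-↔)
open import Data.Product.Function.NonDependent.Propositional using (_×-↔_)
import Data.Product.Properties as Product
open import Data.Sum.Base using (_⊎_; inj₁; inj₂)
open import Data.Sum.Function.Propositional using (_⊎-↔_)
open import Data.Unit.Base using (⊤; tt)
open import Data.Vec.Base using ([]; _∷_)
open import Function.Base using (_∘_; id)
open import Function.Bundles using (_⇔_; _↔_; mk↔ₛ′; mk⇔; Equivalence; Injection; Inverse)
open import Function.Construct.Composition using (_↔-∘_)
open import Function.Construct.Identity using (↔-id)
open import Function.Construct.Symmetry using (↔-sym)
open import Function.Definitions using (Injective)
open import Function.Properties.Inverse using (↔⇒↣)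
open import Relation.Binary.Construct.Closure.ReflexiveTransitive using (Star; ε; _◅_; gmap)
open import Relation.Binary.Definitions using (DecidableEquality)
open import Relation.Binary.PropositionalEquality
  using (_≡_; _≢_; refl; sym; trans; cong; cong₂; subst; subst₂)
open import Relation.Nullary using (¬_; Dec; yes; no; contradiction)
open import Relation.Nullary.Decidable using (⌊_⌋; _×-dec_; map′; toWitness; fromWitness)

-- Finite sets and the pigeonhole principle.

Finite : Set → Set
Finite X = ∃[ n ] (X ↔ Fin n)

finite-⊎ : ∀ {X Y} → Finite X → Finite Y → Finite (X ⊎ Y)
finite-⊎ (m , f) (n , g) = m + n , ↔-sym Fin.+↔⊎ ↔-∘ (f ⊎-↔ g)

finite-× : ∀ {X Y} → Finite X → Finite Y → Finite (X × Y)
finite-× (m , f) (n , g) = m * n , ↔-sym Fin.*↔× ↔-∘ (f ×-↔ g)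

finite-Bool : Finite Bool
finite-Bool = 2 , ↔-sym Fin.2↔Bool

finite-↔ : ∀ {X Y} → X ↔ Y → Finite Y → Finite X
finite-↔ f (n , g) = n , g ↔-∘ f

Σ-Fin-suc : ∀ {n} (Y : Fin (suc n) → Set) →
            Σ (Fin (suc n)) Y ↔ (Y zero ⊎ Σ (Fin n) (Y ∘ suc))
Σ-Fin-suc Y = mk↔ₛ′
  (λ { (zero , y) → inj₁ y ; (suc i , y) → inj₂ (i , y) })
  (λ { (inj₁ y) → zero , y ; (inj₂ (i , y)) → suc i , y })
  (λ { (inj₁ y) → refl ; (inj₂ (i , y)) → refl })
  (λ { (zero , y) → refl ; (suc i , y) → refl })

finite-Σ-Fin : ∀ n {Y : Fin n → Set} → (∀ i → Finite (Y i)) → Finite (Σ (Fin n) Y)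
finite-Σ-Fin zero    fin = 0 , mk↔ₛ′ proj₁ (λ ()) (λ ()) (λ { (() , _) })
finite-Σ-Fin (suc n) fin =
  finite-↔ (Σ-Fin-suc _) (finite-⊎ (fin zero) (finite-Σ-Fin n (fin ∘ suc)))

finite-Σ : ∀ {X} {Y : X → Set} → Finite X → (∀ x → Finite (Y x)) → Finite (Σ X Y)
finite-Σ {X} {Y} (n , f) fin =
  finite-↔ (↔-sym (Σ-↔ {A = Y ∘ Inverse.from f} {B = Y} (↔-sym f) (↔-id _)))
           (finite-Σ-Fin n (fin ∘ Inverse.from f))

injective⇒≤ : ∀ {X : Set} {m n} → X ↔ Fin n → (f : Fin m → X) → Injective _≡_ _≡_ f → m ≤ n
injective⇒≤ e f f-inj =
  Fin.injective⇒≤ {f = Inverse.to e ∘ f} (λ eq → f-inj (Injection.injective (↔⇒↣ e) eq))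

injective⇒surjective : ∀ {X} → Finite X → (f : X → X) → Injective _≡_ _≡_ f →
                       ∀ y → ∃[ x ] f x ≡ y
injective⇒surjective (suc n , e) f f-inj y with Fin.any? (λ i → to (f (from i)) Fin.≟ to y)
  where open Inverse e using (to; from)
... | yes (i , eq) = Inverse.from e i , Injection.injective (↔⇒↣ e) eq
-- Punching out the missed value would leave an injection of `suc n` elements into `n`.
... | no miss = contradiction
  (injective⇒≤ (↔-id _) (λ i → punchOut (λ eq → miss (i , sym eq))) λ eq →
    Injection.injective (↔⇒↣ (↔-sym e)) (f-inj (Injection.injective (↔⇒↣ e)
      (Fin.punchOut-injective {i = Inverse.to e y} _ _ eq))))
  ℕ.1+n≰n
injective⇒surjective (zero , e) f f-inj y with () ← Inverse.to e y

-- A position in `xs` determines its entry, so distinct values of `f` sit at distinct positions.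
length-≥ : ∀ {X : Set} {n} {xs : List X} (f : Fin n → X) → Injective _≡_ _≡_ f →
           (∀ i → f i ∈ xs) → n ≤ length xs
length-≥ {xs = xs} f f-inj f∈ = Fin.injective⇒≤ {f = λ i → Any.index (f∈ i)} (λ {i} {j} eq →
  f-inj (trans (lookup-index (f∈ i)) (trans (cong (lookup xs) eq) (sym (lookup-index (f∈ j))))))

fresh : ∀ {n} (xs : List (Fin n)) → length xs < n → ∃[ i ] i ∉ xs
fresh {n} xs xs<n = Fin.¬∀⟶∃¬ n (_∈ xs) (λ i → Any.any? (i Fin.≟_) xs)
  (λ all → ℕ.<⇒≱ xs<n (length-≥ id id all))

length-mapMaybe : ∀ {A B : Set} (f : A → Maybe B) xs → length (mapMaybe f xs) ≤ length xs
length-mapMaybe f []       = z≤n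
length-mapMaybe f (x ∷ xs) with f x
... | just _  = s≤s (length-mapMaybe f xs)
... | nothing = ℕ.m≤n⇒m≤1+n (length-mapMaybe f xs)

∈-mapMaybe : ∀ {A B : Set} (f : A → Maybe B) {x y xs} → x ∈ xs → f x ≡ just y → y ∈ mapMaybe f xs
∈-mapMaybe f {x} (here refl) eq with just _ ← f x with refl ← eq = here refl
∈-mapMaybe f {xs = x ∷ xs} (there x∈) eq with f x
... | just _  = there (∈-mapMaybe f x∈ eq)
... | nothing = ∈-mapMaybe f x∈ eq

-- Permutations with prescribed values.

module Transposition {A : Set} (_≟_ : DecidableEquality A) where

  transpose : A → A → A → A
  transpose i j k with k ≟ i | k ≟ j
  ... | yes _ | _     = j
  ... | no _  | yes _ = i
  ... | no _  | no _  = k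

  transpose-ˡ : ∀ i j → transpose i j i ≡ j
  transpose-ˡ i j with i ≟ i
  ... | yes _  = refl
  ... | no i≢i = contradiction refl i≢i

  transpose-ʳ : ∀ i j → transpose i j j ≡ i
  transpose-ʳ i j with j ≟ i | j ≟ j
  ... | yes j≡i | _      = j≡i
  ... | no _    | yes _  = refl
  ... | no _    | no j≢j = contradiction refl j≢j

  transpose-≢ : ∀ {i j k} → k ≢ i → k ≢ j → transpose i j k ≡ k
  transpose-≢ {i} {j} {k} k≢i k≢j with k ≟ i | k ≟ j
  ... | yes k≡i | _       = contradiction k≡i k≢i
  ... | no _    | yes k≡j = contradiction k≡j k≢j
  ... | no _    | no _    = refl

  transpose-involutive : ∀ i j k → transpose i j (transpose i j k) ≡ k
  transpose-involutive i j k with k ≟ i | k ≟ j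
  ... | yes refl | _        = transpose-ʳ i j
  ... | no _     | yes refl = transpose-ˡ i j
  ... | no k≢i   | no k≢j   = transpose-≢ k≢i k≢j

  transpose-injective : ∀ i j → Injective _≡_ _≡_ (transpose i j)
  transpose-injective i j {k} {l} eq =
    trans (sym (transpose-involutive i j k)) (trans (cong (transpose i j) eq) (transpose-involutive i j l))

  -- Compose with one transposition per prescribed value.
  extend-to-permutation : ∀ {C : Set} (colour : A → C) (ps : List (A × A)) →
    (∀ {i j i′ j′} → (i , j) ∈ ps → (i′ , j′) ∈ ps → i ≡ i′ → j ≡ j′) →
    (∀ {i j i′ j′} → (i , j) ∈ ps → (i′ , j′) ∈ ps → j ≡ j′ → i ≡ i′) →
    (∀ {i j} → (i , j) ∈ ps → colour i ≡ colour j) →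
    ∃[ σ ] Injective _≡_ _≡_ σ × (∀ {i j} → (i , j) ∈ ps → σ i ≡ j) ×
           (∀ i → colour i ≡ colour (σ i))
  extend-to-permutation colour [] _ _ _ = id , id , (λ ()) , λ _ → refl
  extend-to-permutation colour ((i , j) ∷ ps) fun inj col
    with σ , σ-inj , σ-ps , σ-col ← extend-to-permutation colour ps
           (λ p q → fun (there p) (there q)) (λ p q → inj (there p) (there q)) (col ∘ there) =
    transpose (σ i) j ∘ σ , σ-inj ∘ transpose-injective (σ i) j , values , colours
    where
    values : ∀ {i′ j′} → (i′ , j′) ∈ (i , j) ∷ ps → transpose (σ i) j (σ i′) ≡ j′
    values (here refl) = transpose-ˡ (σ i) j
    values {i′} {j′} (there p) with i′ ≟ i
    ... | yes refl = trans (transpose-ˡ (σ i) j) (fun (here refl) (there p) refl)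
    -- Here `σ i′` is already `j′`; it differs from `σ i` since `σ` is injective and from `j` by
    -- `inj`, so the transposition leaves it alone.
    ... | no i′≢i  = trans
      (transpose-≢ (i′≢i ∘ σ-inj)
        (λ eq → i′≢i (sym (inj (here refl) (there p) (trans (sym eq) (σ-ps p))))))
      (σ-ps p)

    -- The two values that are swapped, `σ i` and `j`, both have the colour of `i`.
    colours : ∀ k → colour k ≡ colour (transpose (σ i) j (σ k))
    colours k with σ k ≟ σ i | σ k ≟ j
    ... | yes eq | _      = trans (trans (σ-col k) (trans (cong colour eq) (sym (σ-col i)))) (col (here refl))
    ... | no _   | yes eq = trans (σ-col k) (trans (cong colour eq) (trans (sym (col (here refl))) (σ-col i)))
    ... | no _   | no _   = σ-col k

-- Cardinalities.

card-transport : ∀ {X : Set} {P P′ : X → Set} {n} (f : X → X) → Injective _≡_ _≡_ f →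
                 (∀ y → ∃[ x ] f x ≡ y) → (∀ x → P x → P′ (f x)) → (∀ x → P′ (f x) → P x) →
                 ∣ P ∣≡ n → ∣ P′ ∣≡ n
card-transport {P = P} {P′} f f-inj f-surj to from (xs , xs! , xs-P , len) =
  map f xs , Unique.map⁺ f-inj xs! , (λ y → mk⇔ (sound y) (complete y)) , trans (length-map f xs) len
  where
  sound : ∀ y → y ∈ map f xs → P′ y
  sound y y∈ with x , x∈ , refl ← ∈-map⁻ f y∈ = to x (Equivalence.to (xs-P x) x∈)

  complete : ∀ y → P′ y → y ∈ map f xs
  complete y p with x , refl ← f-surj y = ∈-map⁺ f (Equivalence.from (xs-P x) (from x p))

-- Meant for the in-neighbours of a tree vertex: the in-degree `suc d` is then 1, so that limited
-- recursion divides its resource by 1.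
card-subsingleton : ∀ {X : Set} {P : X → Set} {d} → (∀ {x y} → P x → P y → x ≡ y) →
                    ∣ P ∣≡ suc d → d ≡ 0
card-subsingleton P-prop (_ ∷ [] , _ , _ , refl) = refl
card-subsingleton P-prop (x ∷ y ∷ _ , ((x≢y ∷ _) ∷ _) , xs-P , _) = contradiction
  (P-prop (Equivalence.to (xs-P x) (here refl)) (Equivalence.to (xs-P y) (there (here refl)))) x≢y

card-singleton : ∀ {X : Set} {P : X → Set} {x} → P x → (∀ {y} → P y → y ≡ x) → ∣ P ∣≡ 1
card-singleton {x = x} p P-prop =
  x ∷ [] , [] ∷ [] , (λ y → mk⇔ (λ { (here refl) → p }) (here ∘ P-prop)) , refl

-- The trees.

Kind : Set
Kind = Bool × Bool

switch : Kind → Bool → Bool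
switch (p , q) false = p
switch (p , q) true  = q

_≟ᵏ_ : DecidableEquality Kind
_≟ᵏ_ = Product.≡-dec Bool._≟_ Bool._≟_

module Tree (Q : ℕ) where

  data Digit : Set where
    plain : Kind → Fin Q → Digit
    slot  : Bool → Bool → Digit

  -- With x the switch `s`, the slots with `e` false and `e` true have kinds (false , x) and (true ,
  -- not x), so the xor of the two components is x for both. Each component on its own takes both
  -- values as `e` varies, which is why the grandchildren do not betray x.
  kid : Kind → Digit → Kind
  kid κ (plain κ′ _) = κ′
  kid κ (slot s e)   = e , e xor switch κ s

  digit↔ : Digit ↔ ((Kind × Fin Q) ⊎ (Bool × Bool))
  digit↔ = mk↔ₛ′
    (λ { (plain κ n) → inj₁ (κ , n) ; (slot s e) → inj₂ (s , e) })
    (λ { (inj₁ (κ , n)) → plain κ n ; (inj₂ (s , e)) → slot s e })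
    (λ { (inj₁ _) → refl ; (inj₂ _) → refl })
    (λ { (plain _ _) → refl ; (slot _ _) → refl })

  finite-Digit : Finite Digit
  finite-Digit = finite-↔ digit↔
    (finite-⊎ (finite-× (finite-× finite-Bool finite-Bool) (Q , ↔-id _))
              (finite-× finite-Bool finite-Bool))

  _≟_ : DecidableEquality Digit
  plain κ m ≟ plain κ′ n =
    map′ (λ { (refl , refl) → refl }) (λ { refl → refl , refl }) (κ ≟ᵏ κ′ ×-dec m Fin.≟ n)
  plain _ _ ≟ slot _ _   = no λ ()
  slot _ _  ≟ plain _ _  = no λ ()
  slot s e  ≟ slot s′ e′ =
    map′ (λ { (refl , refl) → refl }) (λ { refl → refl , refl }) (s Bool.≟ s′ ×-dec e Bool.≟ e′)

  infixr 5 _▹_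

  -- The subtree below a vertex of height h and kind κ, vertices being named by
  -- their paths.  At height 0 only the vertices of kind (true , true) exist, so
  -- that the leaves below a vertex of height 1 already reveal its kind.
  data Node : ℕ → Kind → Set where
    leaf : Node zero (true , true)
    here : ∀ {h κ} → Node (suc h) κ
    _▹_  : ∀ {h κ} (i : Digit) → Node h (kid κ i) → Node (suc h) κ

  ▹-digit : ∀ {h κ i j} {a : Node h (kid κ i)} {b : Node h (kid κ j)} →
            _≡_ {A = Node (suc h) κ} (i ▹ a) (j ▹ b) → i ≡ j
  ▹-digit refl = refl

  ▹-tail : ∀ {h κ i} {a b : Node h (kid κ i)} →
           _≡_ {A = Node (suc h) κ} (i ▹ a) (i ▹ b) → a ≡ b
  ▹-tail refl = refl

  ▹▹-digits : ∀ {h κ i j i′ j′} {a : Node h (kid (kid κ i) j)} {a′ : Node h (kid (kid κ i′) j′)} →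
              _≡_ {A = Node (2 + h) κ} (i ▹ (j ▹ a)) (i′ ▹ (j′ ▹ a′)) → j ≡ j′ × i ≡ i′
  ▹▹-digits refl = refl , refl

  node↔ : ∀ h κ → Node (suc h) κ ↔ (⊤ ⊎ Σ[ i ∈ Digit ] Node h (kid κ i))
  node↔ h κ = mk↔ₛ′
    (λ { here → inj₁ tt ; (i ▹ a) → inj₂ (i , a) })
    (λ { (inj₁ tt) → here ; (inj₂ (i , a)) → i ▹ a })
    (λ { (inj₁ _) → refl ; (inj₂ _) → refl })
    (λ { here → refl ; (_ ▹ _) → refl })

  finite-Node : ∀ h κ → Finite (Node h κ)
  finite-Node zero (true , true)  = 1 , mk↔ₛ′ (λ _ → zero) (λ _ → leaf) (λ { zero → refl }) (λ { leaf → refl })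
  finite-Node zero (true , false) = 0 , mk↔ₛ′ (λ ()) (λ ()) (λ ()) (λ ())
  finite-Node zero (false , q)    = 0 , mk↔ₛ′ (λ ()) (λ ()) (λ ()) (λ ())
  finite-Node (suc h) κ = finite-↔ (node↔ h κ)
    (finite-⊎ (1 , ↔-sym Fin.1↔⊤) (finite-Σ finite-Digit (λ i → finite-Node h (kid κ i))))

  -- The length of the longest common prefix; meet a a is the depth of a.
  meet : ∀ {h κ} → Node h κ → Node h κ → ℕ
  meet leaf    _    = 0
  meet here    _    = 0
  meet (i ▹ a) here = 0
  meet (i ▹ a) (j ▹ b) with i ≟ j
  ... | yes refl = suc (meet a b)
  ... | no  _    = 0

  meet-here : ∀ {h κ} (a : Node (suc h) κ) → meet a here ≡ 0
  meet-here here    = refl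
  meet-here (_ ▹ _) = refl

  meet-▹ : ∀ {h κ} i (a b : Node h (kid κ i)) → meet {κ = κ} (i ▹ a) (i ▹ b) ≡ suc (meet a b)
  meet-▹ i a b with i ≟ i
  ... | yes refl = refl
  ... | no  i≢i  = contradiction refl i≢i

  meet-≢ : ∀ {h κ i j} {a : Node h (kid κ i)} {b} → i ≢ j → meet {κ = κ} (i ▹ a) (j ▹ b) ≡ 0
  meet-≢ {i = i} {j} i≢j with i ≟ j
  ... | yes i≡j = contradiction i≡j i≢j
  ... | no  _   = refl

  meet-suc : ∀ {h κ n i j} {a : Node h (kid κ i)} {b} →
             meet {κ = κ} (i ▹ a) (j ▹ b) ≡ suc n → i ≡ j
  meet-suc {i = i} {j} eq with i ≟ j
  ... | yes i≡j = i≡j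

  -- A path that shares its whole length with another one is a prefix of it, and two paths that are
  -- prefixes of each other coincide.
  meet-injective : ∀ {h κ} (a b : Node h κ) →
                   meet a b ≡ meet a a → meet a b ≡ meet b b → a ≡ b
  meet-injective leaf leaf _ _ = refl
  meet-injective here here _ _ = refl
  meet-injective here (i ▹ b) _ eq with () ← trans eq (meet-▹ i b b)
  meet-injective (i ▹ a) here eq _ with () ← trans eq (meet-▹ i a a)
  meet-injective (i ▹ a) (j ▹ b) eq₁ eq₂ with refl ← meet-suc {a = a} {b} (trans eq₁ (meet-▹ i a a)) =
    cong (i ▹_) (meet-injective a b
      (ℕ.suc-injective (trans (sym (meet-▹ i a b)) (trans eq₁ (meet-▹ i a a))))
      (ℕ.suc-injective (trans (sym (meet-▹ i a b)) (trans eq₂ (meet-▹ i b b)))))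

  -- The first path is a prefix of the second and one digit shorter. Phrased by `meet` alone, so
  -- that whatever preserves `meet` preserves edges.
  Child : ∀ {h κ} → Node h κ → Node h κ → Set
  Child a b = meet a b ≡ meet a a × meet b b ≡ suc (meet a a)

  child? : ∀ {h κ} (a b : Node h κ) → Dec (Child a b)
  child? a b = (meet a b ℕ.≟ meet a a) ×-dec (meet b b ℕ.≟ suc (meet a a))

  child-▹ : ∀ {h κ} i {a b : Node h (kid κ i)} → Child a b → Child {κ = κ} (i ▹ a) (i ▹ b)
  child-▹ i {a} {b} (p , q) =
    trans (meet-▹ i a b) (trans (cong suc p) (sym (meet-▹ i a a))) ,
    trans (meet-▹ i b b) (cong suc (trans q (sym (meet-▹ i a a))))

  child-▹⁻ : ∀ {h κ i} {a : Node h (kid κ i)} {b} → Child {κ = κ} (i ▹ a) b →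
             ∃[ b′ ] b ≡ i ▹ b′ × Child a b′
  child-▹⁻ {i = i} {a} {here} (_ , ())
  child-▹⁻ {i = i} {a} {j ▹ b} (p , q)
    with refl ← meet-suc {a = a} {b} (trans p (meet-▹ i a a)) =
    b , refl ,
    ℕ.suc-injective (trans (sym (meet-▹ i a b)) (trans p (meet-▹ i a a))) ,
    ℕ.suc-injective (trans (sym (meet-▹ i b b)) (trans q (cong suc (meet-▹ i a a))))

  child-unique : ∀ {h κ} {a a′ b : Node h κ} → Child a b → Child a′ b → a ≡ a′
  child-unique {a = leaf} {leaf} _ _ = refl
  child-unique {a = here} {here} _ _ = refl
  child-unique {a = here} {i ▹ a′} {b} (_ , q) (_ , q′)
    with () ← trans (ℕ.suc-injective (trans (sym q) q′)) (meet-▹ i a′ a′)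
  child-unique {a = i ▹ a} {here} {b} (_ , q) (_ , q′)
    with () ← trans (sym (meet-▹ i a a)) (ℕ.suc-injective (trans (sym q) q′))
  child-unique {a = i ▹ a} {i′ ▹ a′} {b} c c′
    with _ , refl , d ← child-▹⁻ {a = a} {b} c with _ , refl , d′ ← child-▹⁻ {a = a′} {b} c′ =
    cong (i ▹_) (child-unique d d′)

  top : ∀ {h κ} → Node h κ → Node h κ
  top leaf    = leaf
  top here    = here
  top (_ ▹ _) = here

  meet-top : ∀ {h κ} (a b : Node h κ) → meet (top a) b ≡ 0
  meet-top leaf    b = refl
  meet-top here    b = refl
  meet-top (_ ▹ _) b = refl

  child-here : ∀ {h κ} i (a : Node h (kid κ i)) → meet a a ≡ 0 → Child {κ = κ} here (i ▹ a)
  child-here i a z = refl , trans (meet-▹ i a a) (cong suc z)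

  child-here⁻ : ∀ {h κ} {b : Node (suc h) κ} → Child here b → ∃[ i ] ∃[ a ] b ≡ i ▹ a × meet a a ≡ 0
  child-here⁻ {b = here} (_ , ())
  child-here⁻ {b = i ▹ a} (_ , eq) = i , a , refl , ℕ.suc-injective (trans (sym (meet-▹ i a a)) eq)

  reachable : ∀ {h κ} (a : Node h κ) → Star Child (top a) a
  reachable leaf    = ε
  reachable here    = ε
  reachable (i ▹ a) = child-here i (top a) (meet-top a (top a)) ◅ gmap (i ▹_) (child-▹ i) (reachable a)

  -- Abstract, since normalising the number of vertices exhausts memory.
  abstract
    count : ∀ h κ → ∃[ n ] (Node (suc h) κ ↔ Fin (suc n))
    count h κ = _ , proj₂ (finite-Node (suc h) κ)

  -- The height is `suc h` because at height 0 there is no vertex for three of the four kinds.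
  tree : ℕ → Kind → Structure τE
  tree h κ = record
    { V       = Node (suc h) κ
    ; pred∣V∣ = proj₁ (count h κ)
    ; finite  = proj₂ (count h κ)
    ; rel     = λ { _ (a ∷ b ∷ []) → ⌊ child? a b ⌋ }
    }

  tree-isDirectedTree : ∀ h κ → IsDirectedTree (tree h κ)
  tree-isDirectedTree h κ = record
    { root          = here
    ; root-orphan   = λ a e → not-child {a} (toWitness e)
    ; unique-parent = λ e e′ → child-unique (toWitness e) (toWitness e′)
    ; reachable     = λ { here → ε
                        ; (i ▹ a) → gmap id fromWitness (reachable (i ▹ a)) }
    }
    where
    not-child : ∀ {a : Node (suc h) κ} → ¬ Child a here
    not-child (_ , ())

-- Partial matchings of vertices and their extension by one pair.

module Game (Q : ℕ) where
  open Tree Q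

  -- Equal depths, and equal kinds along the two paths at heights below d.
  data Sim (d : ℕ) : ∀ {h κ κ′} → Node h κ → Node h κ′ → Set where
    leaf : Sim d leaf leaf
    here : ∀ {h κ κ′} → (suc h < d → κ ≡ κ′) → Sim d (here {h} {κ}) (here {h} {κ′})
    step : ∀ {h κ κ′ i j} {a : Node h (kid κ i)} {b : Node h (kid κ′ j)} →
           (suc h < d → κ ≡ κ′) → Sim d a b → Sim d (i ▹ a) (j ▹ b)

  sim-refl : ∀ {d h κ} (a : Node h κ) → Sim d a a
  sim-refl leaf    = leaf
  sim-refl here    = here (λ _ → refl)
  sim-refl (i ▹ a) = step (λ _ → refl) (sim-refl a)

  sim-sym : ∀ {d h κ κ′} {a : Node h κ} {b : Node h κ′} → Sim d a b → Sim d b a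
  sim-sym leaf       = leaf
  sim-sym (here c)   = here (sym ∘ c)
  sim-sym (step c s) = step (sym ∘ c) (sim-sym s)

  sim-mono : ∀ {d d′ h κ κ′} {a : Node h κ} {b : Node h κ′} → d′ ≤ d → Sim d a b → Sim d′ a b
  sim-mono d′≤d leaf       = leaf
  sim-mono d′≤d (here c)   = here (λ h<d′ → c (ℕ.≤-trans h<d′ d′≤d))
  sim-mono d′≤d (step c s) = step (λ h<d′ → c (ℕ.≤-trans h<d′ d′≤d)) (sim-mono d′≤d s)

  sim-kind : ∀ {d h κ κ′} {a : Node h κ} {b : Node h κ′} → Sim d a b → h < d → κ ≡ κ′
  sim-kind leaf       _ = refl
  sim-kind (here c)   = c
  sim-kind (step c _) = c

  sim-depth : ∀ {d h κ κ′} {a : Node h κ} {b : Node h κ′} → Sim d a b → meet a a ≡ meet b b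
  sim-depth leaf     = refl
  sim-depth (here _) = refl
  sim-depth (step {i = i} {j} {a} {b} _ s) =
    trans (meet-▹ i a a) (trans (cong suc (sim-depth s)) (sym (meet-▹ j b b)))

  -- The two kinds may differ because the recursions below descend into matched subtrees, whose
  -- kinds need to agree only at small heights.
  Pairs : ℕ → Kind → Kind → Set
  Pairs h κ κ′ = List (Node h κ × Node h κ′)

  Similar : ∀ {h κ κ′} → ℕ → Pairs h κ κ′ → Set
  Similar d P = ∀ {a b} → (a , b) ∈ P → Sim d a b

  Aligned : ∀ {h κ κ′} → Node h κ → Node h κ′ → Pairs h κ κ′ → Set
  Aligned a b P = ∀ {a′ b′} → (a′ , b′) ∈ P → meet a a′ ≡ meet b b′

  Isometric : ∀ {h κ κ′} → Pairs h κ κ′ → Set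
  Isometric P = ∀ {a b} → (a , b) ∈ P → Aligned a b P

  record Good {h κ κ′} (d : ℕ) (P : Pairs h κ κ′) : Set where
    field
      similar   : Similar d P
      isometric : Isometric P
  open Good

  meet-comm : ∀ {h κ} (a b : Node h κ) → meet a b ≡ meet b a
  meet-comm leaf leaf = refl
  meet-comm here b = sym (meet-here b)
  meet-comm (i ▹ a) here = refl
  meet-comm {κ = κ} (i ▹ a) (j ▹ b) with i ≟ j
  ... | yes refl = trans (cong suc (meet-comm a b)) (sym (meet-▹ i b a))
  ... | no  i≢j  = sym (meet-≢ {κ = κ} (i≢j ∘ sym))

  good-∷ : ∀ {d h κ κ′ a b} {P : Pairs h κ κ′} →
           Good d P → Sim d a b → Aligned a b P → Good d ((a , b) ∷ P)
  good-∷ {d} {a = a} {b} {P} G s al = record { similar = sim ; isometric = iso }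
    where
    sim : Similar d ((a , b) ∷ P)
    sim (here refl) = s
    sim (there p)   = similar G p

    iso : Isometric ((a , b) ∷ P)
    iso (here refl) (here refl) = sim-depth s
    iso (here refl) (there q)   = al q
    iso (there p)   (here refl) = trans (meet-comm _ a) (trans (al p) (meet-comm b _))
    iso (there p)   (there q)   = isometric G p q

  good-⊆ : ∀ {d h κ κ′} {P P′ : Pairs h κ κ′} → (∀ {p} → p ∈ P′ → p ∈ P) → Good d P → Good d P′
  good-⊆ P′⊆P G = record
    { similar   = λ p → similar G (P′⊆P p)
    ; isometric = λ p q → isometric G (P′⊆P p) (P′⊆P q)
    }

  good-swap : ∀ {d h κ κ′} {P : Pairs h κ κ′} {P′ : Pairs h κ′ κ} →
              (∀ {a b} → (b , a) ∈ P′ → (a , b) ∈ P) → Good d P → Good d P′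
  good-swap P′⊆P G = record
    { similar   = λ p → sim-sym (similar G (P′⊆P p))
    ; isometric = λ p q → sym (isometric G (P′⊆P p) (P′⊆P q))
    }

  good-mono : ∀ {d d′ h κ κ′} {P : Pairs h κ κ′} → d′ ≤ d → Good d P → Good d′ P
  good-mono d′≤d G = record
    { similar = λ p → sim-mono d′≤d (similar G p) ; isometric = isometric G }

  -- By isometry `b` and `b′` share a prefix as long as each of them.
  good-≡ : ∀ {d h κ κ′ a a′ b b′} {P : Pairs h κ κ′} → Good d P →
           (a , b) ∈ P → (a′ , b′) ∈ P → a ≡ a′ → b ≡ b′
  good-≡ {b = b} {b′} G p q refl = meet-injective b b′
    (trans (sym (isometric G p q)) (isometric G p p))
    (trans (sym (isometric G p q)) (isometric G q q))

  good-child : ∀ {d h κ κ′ a a′ b b′} {P : Pairs h κ κ′} → Good d P →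
               (a , b) ∈ P → (a′ , b′) ∈ P → Child a a′ → Child b b′
  good-child G p q (u , v) =
    trans (sym (isometric G p q)) (trans u (isometric G p p)) ,
    trans (sym (isometric G q q)) (trans v (cong suc (isometric G p p)))

  -- In a good list left and right first digits determine each other, so if `i` is matched with `j`,
  -- no pair below either digit is lost.
  restrict : ∀ {h κ κ′} i j → Pairs (suc h) κ κ′ → Pairs h (kid κ i) (kid κ′ j)
  restrict i j [] = []
  restrict i j ((i′ ▹ a , j′ ▹ b) ∷ P) with i′ ≟ i | j′ ≟ j
  ... | yes refl | yes refl = (a , b) ∷ restrict i j P
  ... | yes refl | no  _    = restrict i j P
  ... | no  _    | _        = restrict i j P
  restrict i j ((here  , _)    ∷ P) = restrict i j P
  restrict i j ((_ ▹ _ , here) ∷ P) = restrict i j P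

  restrict-length : ∀ {h κ κ′} i j (P : Pairs (suc h) κ κ′) → length (restrict i j P) ≤ length P
  restrict-length i j [] = z≤n
  restrict-length i j ((i′ ▹ a , j′ ▹ b) ∷ P) with i′ ≟ i | j′ ≟ j
  ... | yes refl | yes refl = s≤s (restrict-length i j P)
  ... | yes refl | no  _    = ℕ.m≤n⇒m≤1+n (restrict-length i j P)
  ... | no  _    | _        = ℕ.m≤n⇒m≤1+n (restrict-length i j P)
  restrict-length i j ((here  , _)    ∷ P) = ℕ.m≤n⇒m≤1+n (restrict-length i j P)
  restrict-length i j ((_ ▹ _ , here) ∷ P) = ℕ.m≤n⇒m≤1+n (restrict-length i j P)

  restrict⁺ : ∀ {h κ κ′ i j a b} {P : Pairs (suc h) κ κ′} →
              (i ▹ a , j ▹ b) ∈ P → (a , b) ∈ restrict i j P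
  restrict⁺ {i = i} {j} {P = (i′ ▹ a , j′ ▹ b) ∷ P} p with i′ ≟ i | j′ ≟ j | p
  ... | yes refl | yes refl | here refl = here refl
  ... | yes refl | yes refl | there q   = there (restrict⁺ q)
  ... | yes refl | no j≢j   | here refl = contradiction refl j≢j
  ... | yes refl | no _     | there q   = restrict⁺ q
  ... | no i≢i   | _        | here refl = contradiction refl i≢i
  ... | no _     | _        | there q   = restrict⁺ q
  restrict⁺ {P = (here  , _)    ∷ P} (there q) = restrict⁺ q
  restrict⁺ {P = (_ ▹ _ , here) ∷ P} (there q) = restrict⁺ q

  restrict⁻ : ∀ {h κ κ′} i j {a b} (P : Pairs (suc h) κ κ′) →
              (a , b) ∈ restrict i j P → (i ▹ a , j ▹ b) ∈ P
  restrict⁻ i j ((i′ ▹ a , j′ ▹ b) ∷ P) p with i′ ≟ i | j′ ≟ j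
  restrict⁻ i j ((i′ ▹ a , j′ ▹ b) ∷ P) (here refl) | yes refl | yes refl = here refl
  restrict⁻ i j ((i′ ▹ a , j′ ▹ b) ∷ P) (there q)   | yes refl | yes refl = there (restrict⁻ i j P q)
  ... | yes refl | no  _    = there (restrict⁻ i j P p)
  ... | no  _    | _        = there (restrict⁻ i j P p)
  restrict⁻ i j ((here  , _)    ∷ P) p = there (restrict⁻ i j P p)
  restrict⁻ i j ((_ ▹ _ , here) ∷ P) p = there (restrict⁻ i j P p)

  good-restrict : ∀ {d h κ κ′} i j {P : Pairs (suc h) κ κ′} → Good d P → Good d (restrict i j P)
  good-restrict {d} i j {P} G = record { similar = sim ; isometric = iso }
    where
    sim : Similar d (restrict i j P)
    sim p with step _ s ← similar G (restrict⁻ i j P p) = s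

    iso : Isometric (restrict i j P)
    iso {a} {b} p {a′} {b′} q = ℕ.suc-injective (trans (sym (meet-▹ i a a′))
      (trans (isometric G (restrict⁻ i j P p) (restrict⁻ i j P q)) (meet-▹ j b b′)))

  -- Paths with equal first digits have a positive `meet`, and isometry carries this to the other
  -- side.
  same-digit : ∀ {d h κ κ′ i i′ j j′ a a′ b b′} {P : Pairs (suc h) κ κ′} → Good d P →
               (i ▹ a , j ▹ b) ∈ P → (i′ ▹ a′ , j′ ▹ b′) ∈ P → i ≡ i′ → j ≡ j′
  same-digit {i = i} {a = a} {a′} G p q refl =
    meet-suc (trans (sym (isometric G p q)) (meet-▹ i a a′))

  same-digit⁻ : ∀ {d h κ κ′ i i′ j j′ a a′ b b′} {P : Pairs (suc h) κ κ′} → Good d P →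
                (i ▹ a , j ▹ b) ∈ P → (i′ ▹ a′ , j′ ▹ b′) ∈ P → j ≡ j′ → i ≡ i′
  same-digit⁻ {j = j} {b = b} {b′} G p q refl =
    meet-suc (trans (isometric G p q) (meet-▹ j b b′))

  -- Against each pair of the list the new first digits agree on both sides or on neither. In the
  -- first case the comparison moves to the subtrees, in the second both values of `meet` are 0.
  aligned-▹ : ∀ {d h κ κ′ i j a b} {P : Pairs (suc h) κ κ′} → Good d P →
              (∀ {i′ j′ a′ b′} → (i′ ▹ a′ , j′ ▹ b′) ∈ P → i ≡ i′ ⊎ j ≡ j′ → i ≡ i′ × j ≡ j′) →
              Aligned a b (restrict i j P) → Aligned (i ▹ a) (j ▹ b) P
  aligned-▹ {κ = κ} {κ′} {i} {j} {a} {b} {P} G same al p with similar G p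
  ... | here _ = refl
  ... | step {i = i′} {j′} {a′} {b′} _ _ with i ≟ i′ | j ≟ j′
  ...   | yes refl | yes refl = cong suc (al (restrict⁺ p))
  ...   | no _     | no _     = refl
  ...   | yes i≡i′ | no j≢j′  = contradiction (proj₂ (same p (inj₁ i≡i′))) j≢j′
  ...   | no i≢i′  | yes j≡j′ = contradiction (proj₁ (same p (inj₂ j≡j′))) i≢i′

  findDigit : ∀ {h κ κ′} i (P : Pairs (suc h) κ κ′) →
              (∃[ j ] ∃[ a ] ∃[ b ] (i ▹ a , j ▹ b) ∈ P) ⊎
              (∀ {j a b} → (i ▹ a , j ▹ b) ∉ P)
  findDigit i [] = inj₂ λ ()
  findDigit i (p ∷ P) with findDigit i P
  ... | inj₁ (j , a , b , q) = inj₁ (j , a , b , there q)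
  findDigit i ((here , _) ∷ P)         | inj₂ none = inj₂ λ { (there q) → none q }
  findDigit i ((i′ ▹ a , here) ∷ P)    | inj₂ none = inj₂ λ { (there q) → none q }
  findDigit i ((i′ ▹ a , j ▹ b) ∷ P)   | inj₂ none with i ≟ i′
  ... | yes refl = inj₁ (j , a , b , here refl)
  ... | no  i≢i′ = inj₂ λ { (here refl) → i≢i′ refl ; (there q) → none q }

  plainDigit : ∀ {h κ κ′} → Node h κ × Node h κ′ → Maybe (Fin Q)
  plainDigit (_ , plain _ n ▹ _) = just n
  plainDigit (_ , _)             = nothing

  forth : ∀ {d h κ κ′} {P : Pairs h κ κ′} → 0 < d → Good d P → length P < Q →
          (h < d → κ ≡ κ′) → (a : Node h κ) → ∃[ b ] Sim d a b × Aligned a b P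
  -- At height 0 a vertex exists only for kind (true , true); `0 < d` guarantees that the other side
  -- has this kind too.
  forth 0<d G P<Q c leaf with refl ← c 0<d = leaf , leaf , λ _ → refl
  forth 0<d G P<Q c here = here , here c , λ _ → refl
  forth {P = P} 0<d G P<Q c (i ▹ a) with findDigit i P
  -- The digit is matched already, so its partner is forced and the search continues below it.
  ... | inj₁ (j , _ , _ , p)
    with step _ s ← similar G p
    with b , s′ , al ← forth 0<d (good-restrict i j G)
                         (ℕ.≤-<-trans (restrict-length i j P) P<Q) (sim-kind s) a =
    j ▹ b , step c s′ , aligned-▹ G
      (λ { q (inj₁ refl) → refl , same-digit G p q refl
         ; q (inj₂ refl) → same-digit⁻ G p q refl , refl }) al
  ... | inj₂ none
    with n , n∉ ← fresh (mapMaybe plainDigit P) (ℕ.≤-<-trans (length-mapMaybe plainDigit P) P<Q) =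
    -- The hole is `kid κ i`: a plain child may have any kind, so `a` itself fits below it.
    plain _ n ▹ a , step c (sim-refl a) , aligned-▹ G
      (λ { q (inj₁ refl) → contradiction q none
         ; q (inj₂ refl) → contradiction (∈-mapMaybe plainDigit q refl) n∉ })
      (λ q → contradiction (restrict⁻ _ _ P q) none)

-- Bijections of vertices that respect a matching.

module Bijection (Q : ℕ) where
  open Tree Q
  open Game Q
  open Good
  open Transposition _≟_

  cast : ∀ {h κ κ′} → κ ≡ κ′ → Node h κ → Node h κ′
  cast refl a = a

  cast-injective : ∀ {h κ κ′} (eq : κ ≡ κ′) {a b : Node h κ} → cast eq a ≡ cast eq b → a ≡ b
  cast-injective refl eq = eq

  sim-cast : ∀ {d h κ κ′} (eq : κ ≡ κ′) (a : Node h κ) → Sim d a (cast eq a)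
  sim-cast refl a = sim-refl a

  xor-cancel : ∀ x y → (x xor y) xor y ≡ x
  xor-cancel x y = trans (Bool.xor-assoc x y y) (trans (cong (x xor_) (Bool.xor-same y)) (Bool.xor-identityʳ x))

  -- Vertices of any two kinds κ and κ′ have equally many grandchildren of each
  -- kind: those below j are matched by moving i to flip κ κ′ i j.
  flip : Kind → Kind → Digit → Digit → Digit
  flip κ κ′ (slot s e) (slot true _) = slot s ((e xor switch κ s) xor switch κ′ s)
  flip κ κ′ i          _             = i

  flip-kid : ∀ κ κ′ i j → kid (kid κ i) j ≡ kid (kid κ′ (flip κ κ′ i j)) j
  flip-kid κ κ′ (plain _ _) j              = refl
  flip-kid κ κ′ (slot s e)  (plain _ _)    = refl
  flip-kid κ κ′ (slot s e)  (slot false _) = refl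
  flip-kid κ κ′ (slot s e)  (slot true e′) =
    cong (λ x → e′ , e′ xor x) (sym (xor-cancel (e xor switch κ s) (switch κ′ s)))

  flip-involutive : ∀ κ κ′ i j → flip κ′ κ (flip κ κ′ i j) j ≡ i
  flip-involutive κ κ′ (plain _ _) j              = refl
  flip-involutive κ κ′ (slot s e)  (plain _ _)    = refl
  flip-involutive κ κ′ (slot s e)  (slot false _) = refl
  flip-involutive κ κ′ (slot s e)  (slot true _)  = cong (slot s)
    (trans (cong (_xor switch κ s) (xor-cancel (e xor switch κ s) (switch κ′ s)))
           (xor-cancel e (switch κ s)))

  -- Not a map of trees: children of the root keep their digits, while the subtree at each
  -- grandchild may move below another child. This is harmless where no pairs have to be respected.
  flipNode : ∀ {h} κ κ′ → Node (2 + h) κ → Node (2 + h) κ′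
  flipNode κ κ′ here          = here
  flipNode κ κ′ (i ▹ here)    = i ▹ here
  flipNode κ κ′ (i ▹ (j ▹ a)) = flip κ κ′ i j ▹ (j ▹ cast (flip-kid κ κ′ i j) a)

  flipNode-injective : ∀ {h} κ κ′ → Injective _≡_ _≡_ (flipNode {h} κ κ′)
  flipNode-injective κ κ′ {here}        {here}        _    = refl
  flipNode-injective κ κ′ {here}        {_ ▹ here}    ()
  flipNode-injective κ κ′ {here}        {_ ▹ (_ ▹ _)} ()
  flipNode-injective κ κ′ {_ ▹ here}    {here}        ()
  flipNode-injective κ κ′ {_ ▹ (_ ▹ _)} {here}        ()
  flipNode-injective κ κ′ {_ ▹ here}    {_ ▹ here}    refl = refl
  flipNode-injective κ κ′ {_ ▹ here}    {_ ▹ (_ ▹ _)} ()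
  flipNode-injective κ κ′ {_ ▹ (_ ▹ _)} {_ ▹ here}    ()
  flipNode-injective κ κ′ {i ▹ (j ▹ a)} {i′ ▹ (j′ ▹ a′)} eq
    with refl , eqᵢ ← ▹▹-digits eq
    with refl ← trans (sym (flip-involutive κ κ′ i j))
                  (trans (cong (λ x → flip κ′ κ x j) eqᵢ) (flip-involutive κ κ′ i′ j))
    = cong (λ b → i ▹ (j ▹ b)) (cast-injective (flip-kid κ κ′ i j) (▹-tail (▹-tail eq)))

  -- Kinds can change only at the heights `2 + h` and `1 + h`, and neither is below `d`.
  sim-flipNode : ∀ {h d} κ κ′ → d ≤ suc h → (a : Node (2 + h) κ) → Sim d a (flipNode κ κ′ a)
  sim-flipNode {h} {d} κ κ′ d≤ a₀ = go a₀
    where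
    high : ∀ {A : Set} {n} → suc h ≤ n → n < d → A
    high h<n n<d = contradiction (ℕ.≤-trans d≤ h<n) (ℕ.<⇒≱ n<d)

    go : ∀ a → Sim d a (flipNode κ κ′ a)
    go here          = here (high (ℕ.n≤1+n _))
    go (i ▹ here)    = step (high (ℕ.n≤1+n _)) (here (high ℕ.≤-refl))
    go (i ▹ (j ▹ a)) = step (high (ℕ.n≤1+n _)) (step (high ℕ.≤-refl) (sim-cast (flip-kid κ κ′ i j) a))

  digitPairs : ∀ {h κ κ′} → Pairs (suc h) κ κ′ → List (Digit × Digit)
  digitPairs []                      = []
  digitPairs ((i ▹ _ , j ▹ _) ∷ P)   = (i , j) ∷ digitPairs P
  digitPairs ((here  , _)     ∷ P)   = digitPairs P
  digitPairs ((_ ▹ _ , here)  ∷ P)   = digitPairs P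

  digitPairs⁺ : ∀ {h κ κ′ i j a b} {P : Pairs (suc h) κ κ′} →
                (i ▹ a , j ▹ b) ∈ P → (i , j) ∈ digitPairs P
  digitPairs⁺ {P = (_ ▹ _ , _ ▹ _) ∷ P} (here refl) = here refl
  digitPairs⁺ {P = (_ ▹ _ , _ ▹ _) ∷ P} (there p)   = there (digitPairs⁺ p)
  digitPairs⁺ {P = (here  , _)     ∷ P} (there p)   = digitPairs⁺ p
  digitPairs⁺ {P = (_ ▹ _ , here)  ∷ P} (there p)   = digitPairs⁺ p

  digitPairs⁻ : ∀ {h κ κ′ i j} (P : Pairs (suc h) κ κ′) →
                (i , j) ∈ digitPairs P → ∃[ a ] ∃[ b ] (i ▹ a , j ▹ b) ∈ P
  digitPairs⁻ ((_ ▹ _ , _ ▹ _) ∷ P) (here refl) = _ , _ , here refl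
  digitPairs⁻ ((_ ▹ _ , _ ▹ _) ∷ P) (there p)   with _ , _ , q ← digitPairs⁻ P p = _ , _ , there q
  digitPairs⁻ ((here  , _)     ∷ P) p           with _ , _ , q ← digitPairs⁻ P p = _ , _ , there q
  digitPairs⁻ ((_ ▹ _ , here)  ∷ P) p           with _ , _ , q ← digitPairs⁻ P p = _ , _ , there q

  extend-digits : ∀ {d h κ κ′} {C : Set} (colour : Digit → C) {P : Pairs (suc h) κ κ′} → Good d P →
    (∀ {i j a b} → (i ▹ a , j ▹ b) ∈ P → colour i ≡ colour j) →
    ∃[ σ ] Injective _≡_ _≡_ σ × (∀ {i j a b} → (i ▹ a , j ▹ b) ∈ P → σ i ≡ j) ×
           (∀ i → colour i ≡ colour (σ i))
  extend-digits colour {P} G col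
    with σ , σ-inj , σ-ps , σ-col ← extend-to-permutation colour (digitPairs P)
      (λ p q → let _ , _ , p′ = digitPairs⁻ P p ; _ , _ , q′ = digitPairs⁻ P q in same-digit G p′ q′)
      (λ p q → let _ , _ , p′ = digitPairs⁻ P p ; _ , _ , q′ = digitPairs⁻ P q in same-digit⁻ G p′ q′)
      (λ p → let _ , _ , p′ = digitPairs⁻ P p in col p′) =
    σ , σ-inj , (λ p → σ-ps (digitPairs⁺ p)) , σ-col

  sim-kid : ∀ {d h κ κ′ i j} {a : Node h (kid κ i)} {b : Node h (kid κ′ j)} →
            Sim d {κ = κ} {κ′} (i ▹ a) (j ▹ b) → h < d → kid κ i ≡ kid κ′ j
  sim-kid (step _ s) = sim-kind s

  -- Where the kinds of the two roots are known to agree, colouring the digits by the kinds of the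
  -- children makes the permutation preserve these kinds. Elsewhere a constant colour does.
  digitPermutation : ∀ {d h κ κ′} {P : Pairs (suc h) κ κ′} → Good d P → (suc h < d → κ ≡ κ′) →
    ∃[ σ ] Injective _≡_ _≡_ σ × (∀ {i j a b} → (i ▹ a , j ▹ b) ∈ P → σ i ≡ j) ×
           (suc h < d → ∀ i → kid κ i ≡ kid κ′ (σ i))
  digitPermutation {d} {h} {κ} G c with suc h ℕ.<? d
  ... | no h≮d
    with σ , σ-inj , σ-P , _ ← extend-digits (λ _ → tt) G (λ _ → refl) =
    σ , σ-inj , σ-P , λ h<d → contradiction h<d h≮d
  ... | yes h<d with refl ← c h<d
    with σ , σ-inj , σ-P , σ-col ← extend-digits (kid κ) G (λ p → sim-kid (similar G p) (ℕ.<⇒≤ h<d)) =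
    σ , σ-inj , σ-P , λ _ → σ-col

  -- Along the matched paths kinds agree at heights below `2 + d`, hence at their children off these
  -- paths below `1 + d`. If the kinds of two unmatched subtrees differ, their height is thus at
  -- least `1 + d`, and flipping disturbs only that height and the next one down. These are the two
  -- heights lost.
  bijection : ∀ {d h κ κ′} {P : Pairs h κ κ′} → 0 < d → Good (2 + d) P → (h < 1 + d → κ ≡ κ′) →
              ∃[ f ] Injective _≡_ _≡_ f × (∀ a → Sim d a (f a)) × (∀ a → Aligned a (f a) P)
  bijection {h = zero} 0<d G c with refl ← c (s≤s z≤n) =
    id , id , sim-refl , λ { leaf _ → refl }
  bijection {d} {suc h} {κ} {κ′} {[]} 0<d G c with κ ≟ᵏ κ′
  ... | yes refl = id , id , sim-refl , λ _ ()
  ... | no κ≢κ′ with suc h ℕ.<? 1 + d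
  ...   | yes h<d = contradiction (c h<d) κ≢κ′
  -- Flipping needs two levels below the root. Height 1 is ruled out by `0 < d`, since it lies below
  -- `1 + d`.
  bijection {suc d} {suc zero} {P = []} 0<d G c | no κ≢κ′ | no h≮d = contradiction (s≤s (s≤s z≤n)) h≮d
  bijection {d} {suc (suc h)} {κ} {κ′} {[]} 0<d G c | no κ≢κ′ | no h≮d =
    flipNode κ κ′ , flipNode-injective κ κ′ ,
    sim-flipNode κ κ′ (s≤s⁻¹ (ℕ.≮⇒≥ h≮d)) , λ _ ()
  bijection {d} {suc h} {κ} {κ′} {P@(p ∷ _)} 0<d G c
    -- A pair of the list shows that the roots agree in kind at heights below `2 + d`, one more than
    -- `c` gives.
    with σ , σ-inj , σ-P , σ-kid ← digitPermutation G (sim-kind (similar G (here refl))) =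
    f , f-inj , f-sim , f-aligned
    where
    below : ∀ i → _
    below i = bijection 0<d (good-restrict i (σ i) G) (λ h<d → σ-kid (s≤s h<d) i)

    f : Node (suc h) κ → Node (suc h) κ′
    f here    = here
    f (i ▹ a) = σ i ▹ proj₁ (below i) a

    f-inj : Injective _≡_ _≡_ f
    f-inj {here}  {here}  _  = refl
    f-inj {i ▹ a} {j ▹ b} eq with refl ← σ-inj (▹-digit eq) =
      cong (i ▹_) (proj₁ (proj₂ (below i)) (▹-tail eq))

    f-sim : ∀ a → Sim d a (f a)
    f-sim here    = here (c ∘ ℕ.m<n⇒m<1+n)
    f-sim (i ▹ a) = step (c ∘ ℕ.m<n⇒m<1+n) (proj₁ (proj₂ (proj₂ (below i))) a)

    f-aligned : ∀ a → Aligned a (f a) P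
    f-aligned here    _ = refl
    f-aligned (i ▹ a) = aligned-▹ G
      (λ { q (inj₁ refl) → refl , σ-P q ; q (inj₂ refl) → σ-inj (sym (σ-P q)) , refl })
      (proj₂ (proj₂ (proj₂ (below i))) a)

-- How many vertices are named at the same time, plus one.
width : ∀ {τ Γ} → Formula τ TC+C Γ → ℕ
width (rel R us)        = 0
width (u ≐ v)           = 0
width (p ≼ q)           = 0
width (¬′ φ)            = width φ
width (φ ∧ ψ)           = width φ ⊔ width ψ
width (φ ∨ ψ)           = width φ ⊔ width ψ
width {Γ = Γ} (∃′ s φ)  = suc (length Γ) ⊔ width φ
width {Γ = Γ} (∀′ s φ)  = suc (length Γ) ⊔ width φ
width (# us φ ps)       = width φ
width {Γ = Γ} (tc us φ ss ts) = suc (length us + (length us + length Γ)) ⊔ width φ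

-- How many heights are lost to counting, two for each counted variable.
rank : ∀ {τ Γ} → Formula τ TC+C Γ → ℕ
rank (rel R us)      = 0
rank (u ≐ v)         = 0
rank (p ≼ q)         = 0
rank (¬′ φ)          = rank φ
rank (φ ∧ ψ)         = rank φ ⊔ rank ψ
rank (φ ∨ ψ)         = rank φ ⊔ rank ψ
rank (∃′ s φ)        = rank φ
rank (∀′ s φ)        = rank φ
rank (# us φ ps)     = length us * 2 + rank φ
rank (tc us φ ss ts) = rank φ

-- Matched assignments satisfy the same formulae of the logic with transitive closure.

module Transfer (Q H : ℕ) (κ₀ : Kind) where
  open Tree Q
  open Game Q
  open Bijection Q

  A : Structure τE
  A = tree H κ₀

  V : Set
  V = Structure.V A

  pairs : ∀ {Γ} → Tuple A Γ → Tuple A Γ → List (V × V)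
  pairs [] [] = []
  pairs {structure ∷ Γ} (a ∷ α) (b ∷ β) = (a , b) ∷ pairs α β
  pairs {number ∷ Γ}    (_ ∷ α) (_ ∷ β) = pairs α β

  SameNumbers : ∀ {Γ} → Tuple A Γ → Tuple A Γ → Set
  SameNumbers [] [] = ⊤
  SameNumbers {structure ∷ Γ} (_ ∷ α) (_ ∷ β) = SameNumbers α β
  SameNumbers {number ∷ Γ}    (m ∷ α) (n ∷ β) = m ≡ n × SameNumbers α β

  -- Both assignments live in the same tree, so numbers can be kept equal and counts compared by
  -- permuting the universe.
  record Related {Γ} (d : ℕ) (α β : Tuple A Γ) : Set where
    constructor _,_
    field
      good        : Good d (pairs α β)
      sameNumbers : SameNumbers α β
  open Related

  length-pairs : ∀ {Γ} (α β : Tuple A Γ) → length (pairs α β) ≤ length Γ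
  length-pairs [] [] = z≤n
  length-pairs {structure ∷ Γ} (_ ∷ α) (_ ∷ β) = s≤s (length-pairs α β)
  length-pairs {number ∷ Γ}    (_ ∷ α) (_ ∷ β) = ℕ.m≤n⇒m≤1+n (length-pairs α β)

  pairs-swap : ∀ {Γ} (α β : Tuple A Γ) {a b} → (b , a) ∈ pairs β α → (a , b) ∈ pairs α β
  pairs-swap [] [] ()
  pairs-swap {structure ∷ Γ} (_ ∷ α) (_ ∷ β) (here refl) = here refl
  pairs-swap {structure ∷ Γ} (_ ∷ α) (_ ∷ β) (there p)   = there (pairs-swap α β p)
  pairs-swap {number ∷ Γ}    (_ ∷ α) (_ ∷ β) p           = pairs-swap α β p

  numbers-sym : ∀ {Γ} (α β : Tuple A Γ) → SameNumbers α β → SameNumbers β α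
  numbers-sym [] [] _ = tt
  numbers-sym {structure ∷ Γ} (_ ∷ α) (_ ∷ β) eqs        = numbers-sym α β eqs
  numbers-sym {number ∷ Γ}    (_ ∷ α) (_ ∷ β) (eq , eqs) = sym eq , numbers-sym α β eqs

  related-sym : ∀ {Γ d} {α β : Tuple A Γ} → Related d α β → Related d β α
  related-sym {α = α} {β} r = good-swap (pairs-swap α β) (good r) , numbers-sym α β (sameNumbers r)

  related-mono : ∀ {Γ d d′} {α β : Tuple A Γ} → d′ ≤ d → Related d α β → Related d′ α β
  related-mono d′≤d (g , eqs) = good-mono d′≤d g , eqs

  pairs-++⁺ˡ : ∀ {us Γ} (a b : Tuple A us) {α β : Tuple A Γ} {p} →
               p ∈ pairs a b → p ∈ pairs (++⁺ a α) (++⁺ b β)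
  pairs-++⁺ˡ [] [] ()
  pairs-++⁺ˡ {structure ∷ us} (_ ∷ a) (_ ∷ b) (here eq) = here eq
  pairs-++⁺ˡ {structure ∷ us} (_ ∷ a) (_ ∷ b) (there p) = there (pairs-++⁺ˡ a b p)
  pairs-++⁺ˡ {number ∷ us}    (_ ∷ a) (_ ∷ b) p         = pairs-++⁺ˡ a b p

  pairs-++⁺ʳ : ∀ {us Γ} (a b : Tuple A us) {α β : Tuple A Γ} {p} →
               p ∈ pairs α β → p ∈ pairs (++⁺ a α) (++⁺ b β)
  pairs-++⁺ʳ []      []      p = p
  pairs-++⁺ʳ {structure ∷ us} (_ ∷ a) (_ ∷ b) p = there (pairs-++⁺ʳ a b p)
  pairs-++⁺ʳ {number ∷ us}    (_ ∷ a) (_ ∷ b) p = pairs-++⁺ʳ a b p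

  pairs-++⁻ : ∀ {us Γ} (a b : Tuple A us) {α β : Tuple A Γ} {p} →
              p ∈ pairs (++⁺ a α) (++⁺ b β) → p ∈ pairs a b ⊎ p ∈ pairs α β
  pairs-++⁻ [] [] p = inj₂ p
  pairs-++⁻ {structure ∷ us} (_ ∷ a) (_ ∷ b) (here eq) = inj₁ (here eq)
  pairs-++⁻ {structure ∷ us} (_ ∷ a) (_ ∷ b) (there p) with pairs-++⁻ a b p
  ... | inj₁ q = inj₁ (there q)
  ... | inj₂ q = inj₂ q
  pairs-++⁻ {number ∷ us}    (_ ∷ a) (_ ∷ b) p = pairs-++⁻ a b p

  numbers-++⁺ : ∀ {us Γ} (a b : Tuple A us) {α β : Tuple A Γ} →
                SameNumbers a b → SameNumbers α β → SameNumbers (++⁺ a α) (++⁺ b β)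
  numbers-++⁺ [] [] _ eqs = eqs
  numbers-++⁺ {structure ∷ us} (_ ∷ a) (_ ∷ b) eqs₁        eqs₂ = numbers-++⁺ a b eqs₁ eqs₂
  numbers-++⁺ {number ∷ us}    (_ ∷ a) (_ ∷ b) (eq , eqs₁) eqs₂ = eq , numbers-++⁺ a b eqs₁ eqs₂

  numbers-++⁻ : ∀ {us Γ} (a b : Tuple A us) {α β : Tuple A Γ} →
                SameNumbers (++⁺ a α) (++⁺ b β) → SameNumbers a b × SameNumbers α β
  numbers-++⁻ [] [] eqs = tt , eqs
  numbers-++⁻ {structure ∷ us} (_ ∷ a) (_ ∷ b) eqs = numbers-++⁻ a b eqs
  numbers-++⁻ {number ∷ us}    (_ ∷ a) (_ ∷ b) (eq , eqs) =
    let eqs₁ , eqs₂ = numbers-++⁻ a b eqs in (eq , eqs₁) , eqs₂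

  pairs-lookup : ∀ {Γ} (α β : Tuple A Γ) (u : Var Γ structure) →
                 (All.lookup α u , All.lookup β u) ∈ pairs α β
  pairs-lookup (_ ∷ α) (_ ∷ β) (here refl) = here refl
  pairs-lookup {structure ∷ Γ} (_ ∷ α) (_ ∷ β) (there u) = there (pairs-lookup α β u)
  pairs-lookup {number ∷ Γ}    (_ ∷ α) (_ ∷ β) (there u) = pairs-lookup α β u

  numbers-lookup : ∀ {Γ} (α β : Tuple A Γ) → SameNumbers α β → (p : Var Γ number) →
                   All.lookup α p ≡ All.lookup β p
  numbers-lookup (_ ∷ α) (_ ∷ β) (eq , _) (here refl) = eq
  numbers-lookup {structure ∷ Γ} (_ ∷ α) (_ ∷ β) eqs       (there p) = numbers-lookup α β eqs p
  numbers-lookup {number ∷ Γ}    (_ ∷ α) (_ ∷ β) (_ , eqs) (there p) = numbers-lookup α β eqs p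

  numbers-lookup* : ∀ {Γ k} (α β : Tuple A Γ) → SameNumbers α β → (ps : Vars Γ (numbers k)) →
                    _⟦_⟧* A α ps ≡ _⟦_⟧* A β ps
  numbers-lookup* {k = zero}  α β eqs []       = refl
  numbers-lookup* {k = suc k} α β eqs (p ∷ ps) =
    cong₂ _∷_ (numbers-lookup α β eqs p) (numbers-lookup* α β eqs ps)

  pairs-lookup* : ∀ {Γ us} (α β : Tuple A Γ) (vs : Vars Γ us) {p} →
                  p ∈ pairs (_⟦_⟧* A α vs) (_⟦_⟧* A β vs) → p ∈ pairs α β
  pairs-lookup* {us = structure ∷ us} α β (v ∷ vs) (here refl) = pairs-lookup α β v
  pairs-lookup* {us = structure ∷ us} α β (v ∷ vs) (there p)   = pairs-lookup* α β vs p
  pairs-lookup* {us = number ∷ us}    α β (v ∷ vs) p           = pairs-lookup* α β vs p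

  numbers-Vars : ∀ {Γ us} (α β : Tuple A Γ) → SameNumbers α β → (vs : Vars Γ us) →
                 SameNumbers (_⟦_⟧* A α vs) (_⟦_⟧* A β vs)
  numbers-Vars α β eqs [] = tt
  numbers-Vars {us = structure ∷ us} α β eqs (v ∷ vs) = numbers-Vars α β eqs vs
  numbers-Vars {us = number ∷ us}    α β eqs (v ∷ vs) =
    numbers-lookup α β eqs v , numbers-Vars α β eqs vs

  -- For the start of a path: values of variables in scope contribute only pairs that are present
  -- already.
  related-++⁺ : ∀ {Γ us d} {α β : Tuple A Γ} → Related d α β → (vs : Vars Γ us) →
                Related d (++⁺ (_⟦_⟧* A α vs) α) (++⁺ (_⟦_⟧* A β vs) β)
  related-++⁺ {α = α} {β} (g , eqs) vs =
    good-⊆ (λ p → absorb (pairs-++⁻ (_⟦_⟧* A α vs) (_⟦_⟧* A β vs) p)) g ,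
    numbers-++⁺ (_⟦_⟧* A α vs) (_⟦_⟧* A β vs) (numbers-Vars α β eqs vs) eqs
    where
    absorb : ∀ {p} → p ∈ pairs (_⟦_⟧* A α vs) (_⟦_⟧* A β vs) ⊎ p ∈ pairs α β → p ∈ pairs α β
    absorb (inj₁ p) = pairs-lookup* α β vs p
    absorb (inj₂ p) = p

  -- For the end of a path: the values under `α` are already paired with those under `β`, and a good
  -- list is a function.
  related-++-≡ : ∀ {Γ us d} {α β : Tuple A Γ} (b : Tuple A us) (vs : Vars Γ us) →
                 Related d (++⁺ (_⟦_⟧* A α vs) α) (++⁺ b β) → b ≡ _⟦_⟧* A β vs
  related-++-≡ {α = α} {β} b₀ vs₀ (g , eqs₀) =
    go b₀ vs₀ (λ p → pairs-++⁺ˡ (_⟦_⟧* A α vs₀) b₀ p) (proj₁ (numbers-++⁻ (_⟦_⟧* A α vs₀) b₀ eqs₀))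
    where
    eqs = proj₂ (numbers-++⁻ (_⟦_⟧* A α vs₀) b₀ eqs₀)

    P : List (V × V)
    P = pairs (++⁺ (_⟦_⟧* A α vs₀) α) (++⁺ b₀ β)

    go : ∀ {us} (b : Tuple A us) (vs : Vars _ us) → (∀ {p} → p ∈ pairs (_⟦_⟧* A α vs) b → p ∈ P) →
         SameNumbers (_⟦_⟧* A α vs) b → b ≡ _⟦_⟧* A β vs
    go [] [] _ _ = refl
    go {structure ∷ us} (b ∷ bs) (v ∷ vs) ⊆P eqs′ = cong₂ _∷_
      (good-≡ g (⊆P (here refl)) (pairs-++⁺ʳ (_⟦_⟧* A α vs₀) b₀ (pairs-lookup α β v)) refl)
      (go bs vs (⊆P ∘ there) eqs′)
    go {number ∷ us} (b ∷ bs) (v ∷ vs) ⊆P (eq , eqs′) = cong₂ _∷_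
      (trans (sym eq) (numbers-lookup α β eqs v)) (go bs vs ⊆P eqs′)

  related-drop : ∀ {Γ us d} {α β : Tuple A Γ} (a b : Tuple A us) →
                 Related d (++⁺ a α) (++⁺ b β) → Related d α β
  related-drop a b (g , eqs) = good-⊆ (pairs-++⁺ʳ a b) g , proj₂ (numbers-++⁻ a b eqs)

  -- Extension puts the successor tuple in front, whereas the formula under `tc` expects the current
  -- tuple first.
  related-exchange : ∀ {Γ us vs d} {α β : Tuple A Γ} (a b : Tuple A us) (a′ b′ : Tuple A vs) →
    Related d (++⁺ a (++⁺ a′ α)) (++⁺ b (++⁺ b′ β)) → Related d (++⁺ a′ (++⁺ a α)) (++⁺ b′ (++⁺ b β))
  related-exchange {α = α} {β} a b a′ b′ (g , eqs) =
    good-⊆ exchange g ,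
    (let eqs₁ , eqs₂ = numbers-++⁻ a b eqs ; eqs₃ , eqs₄ = numbers-++⁻ a′ b′ eqs₂
     in numbers-++⁺ a′ b′ eqs₃ (numbers-++⁺ a b eqs₁ eqs₄))
    where
    exchange : ∀ {p} → p ∈ pairs (++⁺ a′ (++⁺ a α)) (++⁺ b′ (++⁺ b β)) →
               p ∈ pairs (++⁺ a (++⁺ a′ α)) (++⁺ b (++⁺ b′ β))
    exchange p with pairs-++⁻ a′ b′ p
    ... | inj₁ q = pairs-++⁺ʳ a b (pairs-++⁺ˡ a′ b′ q)
    ... | inj₂ q with pairs-++⁻ a b q
    ...   | inj₁ r = pairs-++⁺ˡ a b r
    ...   | inj₂ r = pairs-++⁺ʳ a b (pairs-++⁺ʳ a′ b′ r)

  forth₁ : ∀ {Γ d} {α β : Tuple A Γ} s → 0 < d → length Γ < Q → Related d α β →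
           (a : Element A s) → ∃[ b ] Related {s ∷ Γ} d (a ∷ α) (b ∷ β)
  forth₁ number 0<d Γ<Q (g , eqs) a = a , (g , (refl , eqs))
  forth₁ {α = α} {β} structure 0<d Γ<Q (g , eqs) a
    with b , s , al ← forth 0<d g (ℕ.≤-<-trans (length-pairs α β) Γ<Q) (λ _ → refl) a =
    b , (good-∷ g s al , eqs)

  forth* : ∀ {Γ d} {α β : Tuple A Γ} us → 0 < d → length us + length Γ < Q → Related d α β →
           (a : Tuple A us) → ∃[ b ] Related d (++⁺ a α) (++⁺ b β)
  forth* [] 0<d <Q r [] = [] , r
  forth* {Γ} (s ∷ us) 0<d <Q r (x ∷ a)
    with b , r′ ← forth* us 0<d (ℕ.<⇒≤ <Q) r a
    with y , r″ ← forth₁ s 0<d (subst (_< Q) (sym (length-++ us)) (ℕ.<⇒≤ <Q)) r′ x = y ∷ b , r″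

  Bij : ∀ {X : Set} → (X → X) → Set
  Bij f = Injective _≡_ _≡_ f × (∀ y → ∃[ x ] f x ≡ y)

  bijection₁ : ∀ {Γ d} {α β : Tuple A Γ} s → 0 < d → Related (2 + d) α β →
    ∃[ f ] Bij f × (∀ a → Related {s ∷ Γ} d (a ∷ α) (f a ∷ β))
  bijection₁ number 0<d (g , eqs) =
    id , (id , λ y → y , refl) , λ a → good-mono (ℕ.m≤n+m _ 2) g , (refl , eqs)
  bijection₁ structure 0<d (g , eqs)
    with f , f-inj , f-sim , f-al ← bijection 0<d g (λ _ → refl) =
    f , (f-inj , injective⇒surjective (finite-Node (suc H) κ₀) f f-inj) ,
    λ a → good-∷ (good-mono (ℕ.m≤n+m _ 2) g) (f-sim a) (f-al a) , eqs

  -- The permutation for the first entry depends on the tail, since it must respect the pair of the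
  -- tail with its image. Bijections of the fibres over a bijection of the tails form a bijection.
  bijection* : ∀ {Γ d d′} {α β : Tuple A Γ} us → 0 < d → length us * 2 + d ≤ d′ → Related d′ α β →
    ∃[ f ] Bij f × (∀ (a : Tuple A us) → Related d (++⁺ a α) (++⁺ (f a) β))
  bijection* [] 0<d ≤d′ r = id , (id , λ y → y , refl) , λ { [] → related-mono ≤d′ r }
  bijection* {Γ} {d} {d′} {α} {β} (s ∷ us) 0<d ≤d′ r = f , (f-inj , f-surj) , f-related
    where
    tails : ∃[ f ] Bij f × (∀ (a : Tuple A us) → Related (2 + d) (++⁺ a α) (++⁺ (f a) β))
    tails = bijection* us (ℕ.m≤n⇒m≤1+n (s≤s z≤n)) (subst (_≤ d′)
      (sym (trans (ℕ.+-suc (length us * 2) (suc d)) (cong suc (ℕ.+-suc (length us * 2) d)))) ≤d′) r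

    heads : ∀ (a : Tuple A us) → ∃[ g ] Bij g × (∀ x → Related {s ∷ us ++ Γ} d (x ∷ ++⁺ a α) (g x ∷ ++⁺ (proj₁ tails a) β))
    heads a = bijection₁ s 0<d (proj₂ (proj₂ tails) a)

    f : Tuple A (s ∷ us) → Tuple A (s ∷ us)
    f (x ∷ a) = proj₁ (heads a) x ∷ proj₁ tails a

    tails-bij : Bij (proj₁ tails)
    tails-bij = proj₁ (proj₂ tails)

    heads-bij : ∀ a → Bij (proj₁ (heads a))
    heads-bij a = proj₁ (proj₂ (heads a))

    f-inj : Injective _≡_ _≡_ f
    f-inj {x ∷ a} {y ∷ b} eq = same-heads (proj₁ tails-bij (cong All.tail eq)) eq
      where
      same-heads : a ≡ b → f (x ∷ a) ≡ f (y ∷ b) → _≡_ {A = Tuple A (s ∷ us)} (x ∷ a) (y ∷ b)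
      same-heads refl eq = cong (_∷ a) (proj₁ (heads-bij a) (cong All.head eq))

    f-surj : ∀ y → ∃[ x ] f x ≡ y
    f-surj (y ∷ b) =
      let a , eqₐ = proj₂ tails-bij b ; x , eqₓ = proj₂ (heads-bij a) y
      in x ∷ a , cong₂ _∷_ eqₓ eqₐ

    f-related : ∀ (a : Tuple A (s ∷ us)) → Related d (++⁺ a α) (++⁺ (f a) β)
    f-related (x ∷ a) = proj₂ (proj₂ (heads a)) x

  transfer : ∀ {Γ d} (ψ : Formula τE TC+C Γ) {α β : Tuple A Γ} → width ψ ≤ Q → rank ψ < d →
             Related d α β → _⊨_ A α ψ → _⊨_ A β ψ
  transfer (rel R (u ∷ v ∷ [])) {α} {β} _ _ (g , _) e =
    fromWitness (good-child g (pairs-lookup α β u) (pairs-lookup α β v) (toWitness e))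
  transfer (_≐_ {s = structure} u v) {α} {β} _ _ (g , _) eq =
    good-≡ g (pairs-lookup α β u) (pairs-lookup α β v) eq
  transfer (_≐_ {s = number} p q) {α} {β} _ _ (_ , eqs) eq =
    trans (sym (numbers-lookup α β eqs p)) (trans eq (numbers-lookup α β eqs q))
  transfer (p ≼ q) {α} {β} _ _ (_ , eqs) le =
    subst₂ (λ m n → toℕ m ≤ toℕ n) (numbers-lookup α β eqs p) (numbers-lookup α β eqs q) le
  transfer (¬′ ψ) w<Q r<d r ¬ψ ψβ = ¬ψ (transfer ψ w<Q r<d (related-sym r) ψβ)
  transfer (φ ∧ ψ) w≤Q r<d r (φα , ψα) =
    transfer φ (ℕ.m⊔n≤o⇒m≤o _ _ w≤Q) (ℕ.≤-<-trans (ℕ.m≤m⊔n _ _) r<d) r φα ,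
    transfer ψ (ℕ.m⊔n≤o⇒n≤o _ _ w≤Q) (ℕ.≤-<-trans (ℕ.m≤n⊔m _ _) r<d) r ψα
  transfer (φ ∨ ψ) w≤Q r<d r (inj₁ φα) =
    inj₁ (transfer φ (ℕ.m⊔n≤o⇒m≤o _ _ w≤Q) (ℕ.≤-<-trans (ℕ.m≤m⊔n _ _) r<d) r φα)
  transfer (φ ∨ ψ) w≤Q r<d r (inj₂ ψα) =
    inj₂ (transfer ψ (ℕ.m⊔n≤o⇒n≤o _ _ w≤Q) (ℕ.≤-<-trans (ℕ.m≤n⊔m _ _) r<d) r ψα)
  transfer (∃′ s ψ) w≤Q r<d r (a , ψa)
    with b , r′ ← forth₁ s (ℕ.≤-<-trans z≤n r<d) (ℕ.m⊔n≤o⇒m≤o _ (width ψ) w≤Q) r a =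
    b , transfer ψ (ℕ.m⊔n≤o⇒n≤o _ _ w≤Q) r<d r′ ψa
  transfer (∀′ s ψ) w≤Q r<d r ψα b
    with a , r′ ← forth₁ s (ℕ.≤-<-trans z≤n r<d) (ℕ.m⊔n≤o⇒m≤o _ (width ψ) w≤Q) (related-sym r) b =
    transfer ψ (ℕ.m⊔n≤o⇒n≤o _ _ w≤Q) r<d (related-sym r′) (ψα a)
  transfer {d = d} (# us ψ ps) {α} {β} w≤Q r<d r card
    -- Exactly `suc (rank ψ)` heights are kept for the subformula.
    with f , (f-inj , f-surj) , f-related ← bijection* {d = suc (rank ψ)} us (s≤s z≤n)
      (subst (_≤ d) (sym (ℕ.+-suc (length us * 2) (rank ψ))) r<d) r =
    card-transport f f-inj f-surj
      (λ a → transfer ψ w≤Q ℕ.≤-refl (f-related a))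
      (λ a → transfer ψ w≤Q ℕ.≤-refl (related-sym (f-related a)))
      (subst (λ ns → ∣ _ ∣≡ ⟨_⟩ A ns) (numbers-lookup* α β (sameNumbers r) ps) card)
  transfer {Γ} {d} (tc us ψ ss ts) {α} {β} w≤Q r<d r path =
    lift path refl (_⟦_⟧* A β ss) (related-++⁺ r ss)
    where
    R : Tuple A Γ → Tuple A us → Tuple A us → Set
    R γ a b = _⊨_ A (++⁺ a (++⁺ b γ)) ψ

    lift : ∀ {a t} → Star (R α) a t → t ≡ _⟦_⟧* A α ts → ∀ b → Related d (++⁺ a α) (++⁺ b β) →
           Star (R β) b (_⟦_⟧* A β ts)
    lift ε refl b r′ with refl ← related-++-≡ b ts r′ = ε
    lift {a} (_◅_ {j = a′} e es) eq b r′
      with b′ , r″ ← forth* us (ℕ.≤-<-trans z≤n r<d)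
        (subst (λ n → length us + n < Q) (sym (length-++ us)) (ℕ.m⊔n≤o⇒m≤o _ (width ψ) w≤Q)) r′ a′ =
      -- The old tuples are dropped after each step, so the number of pairs does not grow along the
      -- path, and `d` stays the same.
      let r‴ = related-exchange a′ b′ a b r″ in
      transfer ψ (ℕ.m⊔n≤o⇒n≤o _ _ w≤Q) r<d r‴ e ◅ lift es eq b′ (related-drop a b r‴)

-- The free variables are the vertex to be evaluated and two numbers q and z,
-- with z to be assigned 0, so that every vertex has the labels 0 and q.
edgeφ : Formula τE LREC (structure ∷ structure ∷ structure ∷ number ∷ number ∷ [])
edgeφ = rel zero (here refl ∷ there (here refl) ∷ [])

labelφ : Formula τE LREC (number ∷ structure ∷ structure ∷ number ∷ number ∷ [])
labelφ = (here refl ≐ there (there (there (here refl)))) ∨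
         (here refl ≐ there (there (there (there (here refl)))))

recursion : Formula τE LREC (structure ∷ number ∷ number ∷ [])
recursion = lrec (structure ∷ []) 0 edgeφ labelφ (here refl ∷ []) (there (here refl) ∷ [])

-- Evaluation of the limited recursion.

module Evaluation (Q : ℕ) where
  open Tree Q

  apex : ∀ h {κ} → κ ≡ (true , true) → Node h κ
  apex zero    refl = leaf
  apex (suc h) _    = here

  apex-depth : ∀ h {κ} (eq : κ ≡ (true , true)) → meet (apex h eq) (apex h eq) ≡ 0
  apex-depth zero    refl = refl
  apex-depth (suc h) _    = refl

  apex-unique : ∀ {h κ} (a : Node h κ) eq → meet a a ≡ 0 → a ≡ apex h eq
  apex-unique leaf    refl _ = refl
  apex-unique here    _    _ = refl
  apex-unique (i ▹ a) _    z with () ← trans (sym (meet-▹ i a a)) z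

  -- The image is closed under successors, so apart from in-degrees, which `parent-unique` controls,
  -- limited recursion at it sees only the subtree.
  record Embedding {P : Set} (E : P → P → Set) {h κ} (f : Node h κ → P) : Set where
    field
      injective : Injective _≡_ _≡_ f
      child⁺    : ∀ {a b} → Child a b → E (f a) (f b)
      child⁻    : ∀ {a b} → E (f a) b → ∃[ b′ ] b ≡ f b′ × Child a b′
  open Embedding

  embed-▹ : ∀ {P E h κ} {f : Node (suc h) κ → P} →
            Embedding E f → ∀ i → Embedding E (f ∘ (i ▹_))
  embed-▹ {f = f} emb i = record
    { injective = ▹-tail ∘ injective emb
    ; child⁺    = child⁺ emb ∘ child-▹ i
    ; child⁻    = λ c → let _ , eq , c′ = child⁻ emb c
                            b , eq′ , c″ = child-▹⁻ c′ in b , trans eq (cong f eq′) , c″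
    }

  module _ {P : Set} (E : P → P → Set) (C : P → ℕ → Set)
           (parent-unique : ∀ {a a′ b} → E a b → E a′ b → a ≡ a′)
           (C-Q : ∀ a → C a Q) (C-0 : ∀ a → C a 0) (C-≤ : ∀ {a c} → C a c → c ≤ Q) where

    open LimitedRecursion E C

    -- The family `ac` is arbitrary, so that the lemmas fit whatever accessibility proofs arise from
    -- unfolding `XAcc`.
    Counted : ∀ m → (∀ d → Acc _<_ (m / suc d)) → P → P → Set
    Counted m ac a b =
      E a b × ∃[ d ] (∣ (λ a′ → E a′ b) ∣≡ suc d × XAcc b (m / suc d) (ac d))

    -- The members of X are the vertices of kind (true , true): a vertex of
    -- positive height has Q plain children of that kind, and one more for
    -- each of its switches that is false.
    evaluate⁺ : ∀ {h κ ℓ} {f : Node h κ → P} → Embedding E f → (r : Node h κ) → meet r r ≡ 0 →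
                (ac : Acc _<_ ℓ) → h < ℓ → κ ≡ (true , true) → XAcc (f r) ℓ ac
    evaluate⁻ : ∀ {h κ ℓ} {f : Node h κ → P} → Embedding E f → (r : Node h κ) → meet r r ≡ 0 →
                (ac : Acc _<_ ℓ) → h < ℓ → XAcc (f r) ℓ ac → κ ≡ (true , true)
    kid⁺ : ∀ {h κ m} {f : Node (suc h) κ → P} → Embedding E f →
           ∀ i (eq : kid κ i ≡ (true , true)) (ac : ∀ d → Acc _<_ (m / suc d)) → h < m →
           Counted m ac (f here) (f (i ▹ apex h eq))
    kid⁻ : ∀ {h κ m b} {f : Node (suc h) κ → P} → Embedding E f →
           (ac : ∀ d → Acc _<_ (m / suc d)) → h < m → Counted m ac (f here) b →
           ∃[ i ] Σ[ eq ∈ kid κ i ≡ (true , true) ] b ≡ f (i ▹ apex h eq)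

    -- The leaves are the reason for the label 0.
    evaluate⁺ {f = f} emb leaf _ (acc rec) (s≤s _) _ =
      0 , C-0 _ , [] , [] , (λ b → mk⇔ (λ ()) (λ (e , _) → contradiction e childless)) , refl
      where
      childless : ∀ {b} → ¬ E (f leaf) b
      childless e with leaf , _ , (_ , ()) ← child⁻ emb e
    evaluate⁺ {suc h} {κ} {suc m} {f} emb here _ (acc rec) (s≤s h<m) refl =
      Q , C-Q _ , map b (allFin Q) , Unique.map⁺ b-injective (Unique.allFin⁺ Q) ,
      (λ x → mk⇔ sound complete) , trans (length-map b (allFin Q)) (length-tabulate {n = Q} id)
      where
      b : Fin Q → P
      b n = f (plain (true , true) n ▹ apex h refl)

      b-injective : ∀ {n n′} → b n ≡ b n′ → n ≡ n′
      b-injective eq with refl ← injective emb eq = refl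

      sound : ∀ {x} → x ∈ map b (allFin Q) → Counted m _ (f here) x
      sound x∈ with n , _ , refl ← ∈-map⁻ b x∈ = kid⁺ emb (plain (true , true) n) refl _ h<m

      complete : ∀ {x} → Counted m _ (f here) x → x ∈ map b (allFin Q)
      complete X-x with kid⁻ emb _ h<m X-x
      ... | plain _ n , refl , refl = ∈-map⁺ b (∈-allFin n)
      -- Both switches are true, so a slot child with `e` true has second component false.
      ... | slot true  true , () , _
      ... | slot false true , () , _
    evaluate⁺ emb (i ▹ a) z _ _ _ with () ← trans (sym (meet-▹ i a a)) z

    evaluate⁻ emb leaf _ _ _ _ = refl
    evaluate⁻ {suc h} {κ} {suc m} {f} emb here _ (acc rec) (s≤s h<m) (c , c∈ , xs , _ , xs-P , refl) =
      switches refl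
      where
      -- A false switch adds a slot child to the `Q` plain children that hold, and `Q + 1` exceeds
      -- every label.
      few : ∀ {s} → switch κ s ≢ false
      few {s} eq = ℕ.1+n≰n (ℕ.≤-trans (length-≥ b b-injective b∈) (C-≤ c∈))
        where
        slot-kid : kid κ (slot s true) ≡ (true , true)
        slot-kid = cong (λ x → true , true xor x) eq

        b : Fin (suc Q) → P
        b zero    = f (slot s true ▹ apex h slot-kid)
        b (suc n) = f (plain (true , true) n ▹ apex h refl)

        b-injective : Injective _≡_ _≡_ b
        b-injective {zero}  {zero}   _  = refl
        b-injective {zero}  {suc _}  eq with () ← injective emb eq
        b-injective {suc _} {zero}   eq with () ← injective emb eq
        b-injective {suc _} {suc _}  eq with refl ← injective emb eq = refl

        b∈ : ∀ n → b n ∈ xs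
        b∈ zero    = Equivalence.from (xs-P _) (kid⁺ emb (slot s true) slot-kid _ h<m)
        b∈ (suc n) = Equivalence.from (xs-P _) (kid⁺ emb (plain (true , true) n) refl _ h<m)

      switches : ∀ {κ′} → κ ≡ κ′ → κ′ ≡ (true , true)
      switches {true , true}  _    = refl
      switches {false , _}    refl = contradiction refl (few {false})
      switches {true , false} refl = contradiction refl (few {true})
    evaluate⁻ emb (i ▹ a) z _ _ _ with () ← trans (sym (meet-▹ i a a)) z

    kid⁺ {h} {m = m} {f} emb i eq ac h<m =
      -- The in-degree is 1, so the resource falls from `suc m` to `m` while the height falls from
      -- `suc h` to `h`.
      e , 0 , card-singleton e (λ e′ → parent-unique e′ e) ,
      evaluate⁺ (embed-▹ emb i) (apex h eq) (apex-depth h eq) (ac 0)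
        (subst (h <_) (sym (n/1≡n m)) h<m) eq
      where
      e : E (f here) (f (i ▹ apex h eq))
      e = child⁺ emb (child-here i (apex h eq) (apex-depth h eq))

    kid⁻ {h} {m = m} {f = f} emb ac h<m (e , d , card , X-b)
      with refl ← card-subsingleton parent-unique card
      with b , refl , c ← child⁻ emb e
      with i , a , refl , z ← child-here⁻ {b = b} c =
      let eq = evaluate⁻ (embed-▹ emb i) a z (ac 0) (subst (h <_) (sym (n/1≡n m)) h<m) X-b
      in i , eq , cong (λ x → f (i ▹ x)) (apex-unique a eq z)

-- Separation of the two logics.

module Separation (r Q : ℕ) (r<Q : suc r < suc Q) where
  open Tree (suc Q)
  open Game (suc Q)
  open Transfer (suc Q) (suc r) (true , true)

  open Structure A using (N; ∣V∣; finite)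

  child : (κ : Kind) → Node (suc r) κ → V
  child κ a = plain κ zero ▹ a

  module _ (q z : N) (q≡ : toℕ q ≡ suc Q) (z≡0 : toℕ z ≡ 0) where

    recursion-evaluates : ∀ κ →
      _⊨_ A (child κ here ∷ q ∷ z ∷ []) recursion ⇔ κ ≡ (true , true)
    recursion-evaluates κ = mk⇔
      (evaluate⁻ E C parent-unique C-Q C-0 C-≤ embedding here refl _ r<ℓ)
      (evaluate⁺ E C parent-unique C-Q C-0 C-≤ embedding here refl _ r<ℓ)
      where
      open Evaluation (suc Q)

      α : Assignment A (structure ∷ number ∷ number ∷ [])
      α = child κ here ∷ q ∷ z ∷ []

      E : Tuple A (structure ∷ []) → Tuple A (structure ∷ []) → Set
      E a b = _⊨_ A (++⁺ a (++⁺ b α)) edgeφ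

      C : Tuple A (structure ∷ []) → ℕ → Set
      C a c = ∃[ n ] _⊨_ A (++⁺ n (++⁺ a α)) labelφ × ⟨_⟩ A {1} n ≡ c

      value : ∀ {n k} → toℕ n ≡ k → ⟨_⟩ A {1} (n ∷ []) ≡ k
      value = trans (ℕ.+-identityʳ _)

      parent-unique : ∀ {a a′ b} → E a b → E a′ b → a ≡ a′
      parent-unique {_ ∷ []} {_ ∷ []} {_ ∷ []} e e′ =
        cong (_∷ []) (child-unique (toWitness e) (toWitness e′))

      C-Q : ∀ a → C a (suc Q)
      C-Q (_ ∷ []) = q ∷ [] , inj₁ refl , value q≡

      C-0 : ∀ a → C a 0
      C-0 (_ ∷ []) = z ∷ [] , inj₂ refl , value z≡0

      C-≤ : ∀ {a c} → C a c → c ≤ suc Q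
      C-≤ {_ ∷ []} (_ ∷ [] , inj₁ refl , refl) = ℕ.≤-reflexive (value q≡)
      C-≤ {_ ∷ []} (_ ∷ [] , inj₂ refl , refl) = ℕ.≤-trans (ℕ.≤-reflexive (value z≡0)) z≤n

      embedding : Embedding E (λ a → child κ a ∷ [])
      embedding = record
        { injective = λ eq → ▹-tail (cong All.head eq)
        ; child⁺    = λ c → fromWitness (child-▹ (plain κ zero) c)
        ; child⁻    = λ { {a} {b ∷ []} e → let b′ , eq , c = child-▹⁻ {a = a} {b} (toWitness e)
                                           in b′ , cong (_∷ []) eq , c }
        }

      -- The number `q` is both a label and the resource; its value `suc Q` exceeds the height
      -- `suc r` of the evaluated child.
      r<ℓ : suc r < toℕ q + 0
      r<ℓ = subst (suc r <_) (sym (value q≡)) r<Q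

  -- Makes `suc Q` a possible value of a number variable; the plain children of the root of one kind
  -- are enough vertices.
  Q≤∣V∣ : suc Q ≤ ∣V∣
  Q≤∣V∣ = injective⇒≤ finite (λ n → plain (true , true) n ▹ here) λ { refl → refl }

  related : ∀ κ κ′ {q z} → Related {structure ∷ number ∷ number ∷ []} (suc r)
              (child κ here ∷ q ∷ z ∷ []) (child κ′ here ∷ q ∷ z ∷ [])
  related κ κ′ =
    good-∷ (record { similar = λ () ; isometric = λ () })
      -- Both children have height `suc r`, where kinds are no longer compared, and the root above
      -- them is the same.
      (step (λ _ → refl) (here (λ r<r → contradiction r<r (ℕ.<-irrefl refl)))) (λ ()) ,
    (refl , refl , tt)

  separates : ∀ (ψ : Formula τE TC+C (structure ∷ number ∷ number ∷ [])) →
              width ψ ≤ suc Q → rank ψ ≤ r → ¬ EquivalentOn IsDirectedTree recursion ψ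
  separates ψ w≤Q rank≤r φ⇔ψ = contradiction (to (eval (false , false)) φ-false) λ ()
    where
    open Equivalence

    q : N
    q = fromℕ< (s≤s Q≤∣V∣)

    eval : ∀ κ → _⊨_ A (child κ here ∷ q ∷ zero ∷ []) recursion ⇔ κ ≡ (true , true)
    eval = recursion-evaluates q zero (Fin.toℕ-fromℕ< (s≤s Q≤∣V∣)) refl

    same : ∀ α → _⊨_ A α recursion ⇔ _⊨_ A α ψ
    same = φ⇔ψ A (tree-isDirectedTree _ _)

    φ-false : _⊨_ A (child (false , false) here ∷ q ∷ zero ∷ []) recursion
    φ-false = from (same _) (transfer ψ w≤Q (s≤s rank≤r) (related (true , true) (false , false))
      (to (same _) (from (eval (true , true)) refl)))

corollary4p6 : ∃[ Γ ] Σ[ φ ∈ Formula τE LREC Γ ]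
    ((ψ : Formula τE TC+C Γ) → ¬ EquivalentOn IsDirectedTree φ ψ)
corollary4p6 = _ , recursion , λ ψ →
  -- There are rank plus width plus 2 plain children of each kind: at least the width, and more than
  -- the height `suc (rank ψ)` of the evaluated vertices.
  let open Separation (rank ψ) (suc (rank ψ + width ψ)) (s≤s (s≤s (ℕ.m≤m+n _ _))) in
  separates ψ (ℕ.m≤n⇒m≤1+n (ℕ.m≤n⇒m≤1+n (ℕ.m≤n+m _ _))) ℕ.≤-refl
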